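{- Let $G$ be a graph and let $\varepsilon$ be an end of $G$ with $\deg(\varepsilon)=\aleph_1$. Then $\varepsilon$ has property $HC^*(\aleph_1)$.
   Context: A ray is a one-way infinite path; two rays are equivalent if no finite vertex set separates them; ends are the equivalence classes. $\deg(\varepsilon)$ is the supremum of sizes of families of pairwise disjoint rays in $\varepsilon$. A family of paths is independent if the paths meet only in endpoints. For a family $\mathcal R$ of rays, an $\mathcal R$-family of paths has all endpoints on rays of $\mathcal R$; it is $\mathcal R$-internally disjoint if no path meets a ray of $\mathcal R$ except at its endpoints. The ray graph of $(\mathcal R,\mathcal P)$ (for pairwise disjoint equivalent rays $\mathcal R$ and independent $\mathcal P$) has vertex set $\mathcal R$, with $r,s$ adjacent iff infinitely many paths of $\mathcal P$ join $r$ and $s$. An end $\varepsilon$ of degree $\kappa$ has property $HC^*(\kappa)$ if there is a family $\mathcal R\subseteq\varepsilon$ of $\kappa$ pairwise disjoint rays and an $\mathcal R$-internally disjoint $\mathcal R$-family of paths $\mathcal P$ such that for every countable $\mathcal R'\subseteq\mathcal R$ there are a countable $\mathcal R''$ with $\mathcal R'\subseteq\mathcal R''\subseteq\mathcal R$ and a countable family $\mathcal P''\subseteq\mathcal P$ of independent $\mathcal R''$-paths such that the ray graph of $(\mathcal R'',\mathcal P'')$ is connected. -}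

module Defs where

open import Data.Fin.Base using (Fin; zero; inject₁; fromℕ) renaming (suc to fsuc)
open import Data.List.Base using (List)
open import Data.List.Membership.Propositional using () renaming (_∈_ to _∈ˡ_)
open import Data.Nat.Base using (ℕ; suc)
open import Data.Product.Base using (Σ-syntax; ∃-syntax; _×_; _,_)
open import Data.Refinement using (Refinement-syntax; value; value-injective)
open import Data.Sum.Base using (_⊎_; swap)
open import Function.Base using (_∘_)
open import Function.Bundles using (_↣_; _⇔_; Injection)
open import Function.Definitions using (Injective)
open import Induction.WellFounded using (WellFounded)
open import Level using (Level) renaming (suc to lsuc)
open import Relation.Binary.Construct.Closure.ReflexiveTransitive using (Star)
open import Relation.Binary.Core using (Rel)
open import Relation.Binary.Definitions using (Irreflexive; Symmetric)
open import Relation.Binary.PropositionalEquality using (_≡_; _≢_; ≢-sym; refl)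
open import Relation.Binary.Structures using (IsStrictTotalOrder)
open import Relation.Nullary.Negation using (¬_)
open import Relation.Unary using (Pred; _∈_; _⊆_; Satisfiable)

------------------------------------------------------------------------
-- Cardinality

-- "At most countable": finite and empty types are countable.
Countable : ∀ {ℓ} → Set ℓ → Set ℓ
Countable A = A ↣ ℕ

-- Refinements have irrelevant membership proofs, so this counts elements
-- of the subset, not proofs of membership.
CountableSubset : ∀ {ℓ} {A : Set ℓ} → Pred A ℓ → Set ℓ
CountableSubset {A = A} S = Countable [ x ∈ A ∣ S x ]

-- Order type ω₁, the least uncountable ordinal: an uncountable well-order
-- all of whose proper initial segments are countable.
IsOmega₁ : ∀ {ℓ} {A : Set ℓ} → Rel A ℓ → Set ℓ
IsOmega₁ {A = A} _<_ =
  IsStrictTotalOrder _≡_ _<_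
  × WellFounded _<_
  × ¬ Countable A
  × (∀ x → CountableSubset (λ y → y < x))

-- ℵ₁ is the cardinality of ω₁.
IsAleph₁ : ∀ {ℓ} → Set ℓ → Set (lsuc ℓ)
IsAleph₁ {ℓ} κ = Σ[ R ∈ Rel κ ℓ ] IsOmega₁ R

------------------------------------------------------------------------
-- Graphs

record Graph (ℓ : Level) : Set (lsuc ℓ) where
  field
    Vertex     : Set ℓ
    Adj        : Rel Vertex ℓ
    adj-sym    : Symmetric Adj
    adj-irrefl : Irreflexive _≡_ Adj

Connected : ∀ {ℓ} → Graph ℓ → Set ℓ
Connected H = Vertex × (∀ x y → Star Adj x y)
  where open Graph H

module _ {ℓ : Level} (G : Graph ℓ) where
  open Graph G

  record Ray : Set ℓ where
    field
      vertex    : ℕ → Vertex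
      injective : Injective _≡_ _≡_ vertex
      adjacent  : ∀ n → Adj (vertex n) (vertex (suc n))

  record Path : Set ℓ where
    field
      length    : ℕ
      vertex    : Fin (suc length) → Vertex
      injective : Injective _≡_ _≡_ vertex
      adjacent  : ∀ (i : Fin length) → Adj (vertex (inject₁ i)) (vertex (fsuc i))

    start end : Vertex
    start = vertex zero
    end   = vertex (fromℕ length)

module _ {ℓ : Level} {G : Graph ℓ} where
  open Graph G

  OnRay : Ray G → Pred Vertex ℓ
  OnRay r v = ∃[ n ] Ray.vertex r n ≡ v

  OnPath : Path G → Pred Vertex ℓ
  OnPath p v = ∃[ i ] Path.vertex p i ≡ v

  EndpointOf : Path G → Pred Vertex ℓ
  EndpointOf p v = Path.start p ≡ v ⊎ Path.end p ≡ v

  EdgeOf : Path G → Rel Vertex ℓ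
  EdgeOf p v w = ∃[ i ]
    (vertex (inject₁ i) ≡ v × vertex (fsuc i) ≡ w
     ⊎ vertex (inject₁ i) ≡ w × vertex (fsuc i) ≡ v)
    where open Path p

  -- Equality of paths as subgraphs of G; in particular, a path equals its
  -- reverse.
  infix 4 _≈_
  _≈_ : Rel (Path G) ℓ
  p ≈ q = (∀ v → OnPath p v ⇔ OnPath q v)
        × (∀ v w → EdgeOf p v w ⇔ EdgeOf q v w)

  ----------------------------------------------------------------------
  -- Ends and their degrees

  Separates : List Vertex → Ray G → Ray G → Set ℓ
  Separates X r s = ∀ (p : Path G) → OnRay r (Path.start p) → OnRay s (Path.end p) →
                    ∃[ v ] OnPath p v × v ∈ˡ X

  Equivalent : Rel (Ray G) ℓ
  Equivalent r s = ∀ X → ¬ Separates X r s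

  PairwiseDisjoint : {I : Set ℓ} → (I → Ray G) → Set ℓ
  PairwiseDisjoint R = ∀ {i j} → i ≢ j → ∀ v → OnRay (R i) v → ¬ OnRay (R j) v

module _ {ℓ : Level} (G : Graph ℓ) where

  -- An equivalence class of rays.
  record End : Set (lsuc ℓ) where
    field
      rays     : Pred (Ray G) ℓ
      nonempty : Satisfiable rays
      class    : ∀ {r} → r ∈ rays → ∀ s → s ∈ rays ⇔ Equivalent r s

module _ {ℓ : Level} {G : Graph ℓ} where
  open Graph G

  -- Pairwise disjoint rays are distinct, so such a family has size |I|.
  DisjointFamilyIn : End G → {I : Set ℓ} → (I → Ray G) → Set ℓ
  DisjointFamilyIn ε R = (∀ i → R i ∈ End.rays ε) × PairwiseDisjoint R

  BoundsFamilies : End G → Set ℓ → Set (lsuc ℓ)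
  BoundsFamilies ε μ = ∀ (I : Set ℓ) (R : I → Ray G) → DisjointFamilyIn ε R → I ↣ μ

  -- deg ε = |κ|: the cardinality of κ is the least upper bound.
  HasDegree : End G → Set ℓ → Set (lsuc ℓ)
  HasDegree ε κ = BoundsFamilies ε κ
                × (∀ (μ : Set ℓ) → BoundsFamilies ε μ → κ ↣ μ)

------------------------------------------------------------------------
-- Families of paths

module _ {ℓ : Level} (G : Graph ℓ) where

  -- A set of paths, indexed without repetition so that counting indices
  -- counts paths.
  record PathFamily (Q : Set ℓ) : Set ℓ where
    field
      path     : Q → Path G
      distinct : Injective _≡_ _≈_ path

module _ {ℓ : Level} {G : Graph ℓ} where
  open Graph G
  open PathFamily

  infixl 6 _↾ʳ_ _↾ᵖ_

  _↾ʳ_ : {I : Set ℓ} → (I → Ray G) → (S : Pred I ℓ) → [ i ∈ I ∣ S i ] → Ray G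
  R ↾ʳ S = R ∘ value

  _↾ᵖ_ : {Q : Set ℓ} → PathFamily G Q → (S : Pred Q ℓ) → PathFamily G [ q ∈ Q ∣ S q ]
  P ↾ᵖ S = record
    { path     = path P ∘ value
    ; distinct = λ eq → value-injective (distinct P eq)
    }

  Independent : {Q : Set ℓ} → PathFamily G Q → Set ℓ
  Independent P = ∀ {q q′} → q ≢ q′ → ∀ v → OnPath (path P q) v → OnPath (path P q′) v →
                  EndpointOf (path P q) v × EndpointOf (path P q′) v

  IsFamilyOver : {I Q : Set ℓ} → (I → Ray G) → PathFamily G Q → Set ℓ
  IsFamilyOver R P = ∀ q v → EndpointOf (path P q) v → ∃[ i ] OnRay (R i) v

  InternallyDisjoint : {I Q : Set ℓ} → (I → Ray G) → PathFamily G Q → Set ℓ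
  InternallyDisjoint R P = ∀ q i v → OnPath (path P q) v → OnRay (R i) v →
                           EndpointOf (path P q) v

  Joins : Path G → Rel (Ray G) ℓ
  Joins p r s = OnRay r (Path.start p) × OnRay s (Path.end p)
              ⊎ OnRay s (Path.start p) × OnRay r (Path.end p)

  InfinitelyManyJoin : {Q : Set ℓ} → PathFamily G Q → Rel (Ray G) ℓ
  InfinitelyManyJoin {Q} P r s =
    Σ[ f ∈ ℕ ↣ Q ] (∀ n → Joins (path P (Injection.to f n)) r s)

  -- Rays are represented by their indices, which is faithful when the
  -- family is pairwise disjoint.
  rayGraph : {I Q : Set ℓ} → (I → Ray G) → PathFamily G Q → Graph ℓ
  rayGraph {I} R P = record
    { Vertex     = I
    ; Adj        = λ i j → i ≢ j × InfinitelyManyJoin P (R i) (R j)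
    ; adj-sym    = λ (i≢j , f , joins) → ≢-sym i≢j , f , swap ∘ joins
    ; adj-irrefl = λ i≡j (i≢j , _) → i≢j i≡j
    }

  HC* : End G → Set ℓ → Set (lsuc ℓ)
  HC* ε κ =
    Σ[ R ∈ (κ → Ray G) ] DisjointFamilyIn ε R ×
    Σ[ Q ∈ Set ℓ ] Σ[ P ∈ PathFamily G Q ]
      IsFamilyOver R P × InternallyDisjoint R P ×
      (∀ (R′ : Pred κ ℓ) → CountableSubset R′ →
        Σ[ R″ ∈ Pred κ ℓ ] R′ ⊆ R″ × CountableSubset R″ ×
        Σ[ P″ ∈ Pred Q ℓ ] CountableSubset P″ ×
          IsFamilyOver (R ↾ʳ R″) (P ↾ᵖ P″) ×
          Independent (P ↾ᵖ P″) ×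
          Connected (rayGraph (R ↾ʳ R″) (P ↾ᵖ P″)))

{-# OPTIONS --safe #-}
-- Fix ℵ₁ disjoint rays t i in ε and one ray r₀ of ε.  It suffices to find ℵ₁
-- disjoint rays in ε, disjoint from r₀, each of which can reach r₀ past any
-- finite vertex set and past all the other rays: for countably many of them,
-- disjoint paths to r₀ can then be chosen one at a time, and r₀ becomes the
-- centre of a star in the ray graph.
--
-- Call a vertex set z closed if each vertex of z that reaches r₀ outside a
-- finite set also does so inside z.  Every countable set lies in a countable
-- closed one.  Consider the components of G - z, for z countable and closed,
-- that contain some t i.
--
-- If ℵ₁ of them are pairwise disjoint, they can be thinned out so that each
-- misses the closed sets of its predecessors, and one ray in each suffices: a
-- path to r₀ is rerouted, by well-founded induction, through the closed sets.
--
-- Otherwise maximal disjoint families of such components are countable, so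
-- some countable closed Z contains, for each u in Z, the separators of a
-- maximal disjoint family of big components not adjacent to u; here big means
-- containing, for any given countable set, the start of some t i avoiding it.  A big
-- component C of G - Z then has infinitely many neighbours, all of them
-- adjacent to every big component inside C.  Descending through big
-- components yields, outside any given countable set, a ray of ε with
-- infinitely many disjoint paths to Z, and ω₁ such combs are chosen greedily.
module Submission where

open import Defs
open import Axiom.DoubleNegationElimination using (em⇒dne)
open import Axiom.ExcludedMiddle using (ExcludedMiddle)
open import Axiom.Extensionality.Propositional using (Extensionality)
open import Data.Empty using (⊥-elim)
open import Data.Fin.Base using (Fin; zero; suc; inject₁; fromℕ)
open import Data.List.Base using (List; []; _∷_; _++_; concat; length; map; tabulate)
open import Data.List.Membership.Propositional renaming (_∈_ to _∈ˡ_; _∉_ to _∉ˡ_)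
open import Data.List.Membership.Propositional.Properties using (∈-filter⁺; ∈-filter⁻; ∈-++⁺ˡ; ∈-++⁺ʳ; ∈-++⁻; ∈-concat⁺′; ∈-map⁺; ∈-tabulate⁺)
open import Data.List.Relation.Unary.All.Properties using (all-filter)
open import Data.List.Relation.Unary.All as All using (All; []; _∷_)
open import Data.List.Relation.Unary.Any using (here; there)
open import Data.Bool.Base using (Bool; true)
open import Data.Maybe.Base using (Maybe; just; nothing)
open import Data.Maybe.Properties using (just-injective)
open import Data.Nat.Base using (ℕ; zero; suc; _+_; _≤_; s≤s) renaming (_<_ to _<ℕ_)
open import Data.Nat.Properties using (<⇒≢; +-suc; +-identityʳ; +-comm; <-cmp; ≤-refl; ≤-trans; m≤m+n; m≤n+m; m≤n⇒m<n∨m≡n; ≰⇒>)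
open import Data.Product.Base using (Σ-syntax; ∃-syntax; _×_; _,_; proj₁; proj₂; uncurry)
open import Data.Refinement using (Refinement-syntax; value; value-injective; _,_)
open import Data.Irrelevant using ([_])
open import Data.Sum.Base using (_⊎_; inj₁; inj₂)
open import Data.Unit.Base using (⊤; tt)
open import Function.Base using (_∘_)
open import Function.Bundles using (_↣_; mk↣; Injection; Equivalence; _⇔_; mk⇔)
open import Function.Construct.Composition using (_⇔-∘_)
open import Function.Construct.Identity using (⇔-id)
open import Function.Construct.Symmetry using (⇔-sym)
open import Induction.WellFounded using (WfRec; module All; module FixPoint)
open import Level using (Level; Lift; lift; lower)
open import Relation.Binary.Construct.Closure.ReflexiveTransitive as Star using (Star; _◅_)
open import Relation.Binary.Core using (Rel)
open import Relation.Binary.Definitions using (DecidableEquality; tri<; tri≈; tri>)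
open import Relation.Binary.Structures using (IsStrictTotalOrder)
open import Relation.Binary.PropositionalEquality using (_≡_; _≢_; refl; sym; trans; cong; cong₂; subst; subst₂)
open import Relation.Nullary.Decidable.Core using (Dec; yes; no; does; recompute)
open import Relation.Nullary.Decidable using (does-⇔; dec-true)
open import Relation.Nullary.Negation using (¬_)
open import Relation.Unary using (Pred; Decidable; _∈_; _⊆_)

private
  variable
    a b ℓ : Level

-- Countable sets

-- One step along Cantor's diagonal enumeration of the plane.
diagonalStep : ℕ × ℕ → ℕ × ℕ
diagonalStep (zero  , y) = suc y , 0
diagonalStep (suc x , y) = x , suc y

unpair : ℕ → ℕ × ℕ
unpair zero    = 0 , 0
unpair (suc n) = diagonalStep (unpair n)

unpair-surjective : ∀ x y → ∃[ n ] unpair n ≡ (x , y)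
unpair-surjective x y = go (x + y) y x refl
  where
  -- Induction on the diagonal `s`, then on `y`: the point before `(suc x , 0)` is `(0 , x)`, the
  -- last one of the previous diagonal.
  go : ∀ s y x → x + y ≡ s → ∃[ n ] unpair n ≡ (x , y)
  go s (suc y) x eq
    with n , p ← go s y (suc x) (trans (sym (+-suc x y)) eq)
    = suc n , cong diagonalStep p
  go s zero zero eq = 0 , refl
  go (suc s) zero (suc x) eq
    with n , p ← go s s zero refl
    = suc n , trans (cong diagonalStep p) (cong (_, 0) (sym (trans (sym (+-identityʳ (suc x))) eq)))

listOfLength : ℕ → ℕ → List ℕ
listOfLength zero    n = []
listOfLength (suc k) n = proj₁ (unpair n) ∷ listOfLength k (proj₂ (unpair n))

unlist : ℕ → List ℕ
unlist = uncurry listOfLength ∘ unpair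

listOfLength-surjective : ∀ l → ∃[ c ] listOfLength (length l) c ≡ l
listOfLength-surjective []      = 0 , refl
listOfLength-surjective (x ∷ l)
  with c , p ← listOfLength-surjective l
  with n , q ← unpair-surjective x c
  = n , cong₂ _∷_ (cong proj₁ q) (trans (cong (listOfLength (length l) ∘ proj₂) q) p)

unlist-surjective : ∀ l → ∃[ n ] unlist n ≡ l
unlist-surjective l
  with c , p ← listOfLength-surjective l
  with n , q ← unpair-surjective (length l) c
  = n , trans (cong (uncurry listOfLength) q) p

-- Nonempty countable sets are represented by enumerations.
Range : {A : Set a} → (ℕ → A) → Pred A a
Range w x = ∃[ n ] w n ≡ x

module _ {A : Set a} where

  ⋃ : (ℕ → ℕ → A) → ℕ → A
  ⋃ w = uncurry w ∘ unpair

  ∈⋃ : ∀ w k {x} → Range (w k) x → Range (⋃ w) x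
  ∈⋃ w k (m , refl) with n , p ← unpair-surjective k m = n , cong (uncurry w) p

  either : (ℕ → A) → (ℕ → A) → ℕ → ℕ → A
  either v w zero    = v
  either v w (suc _) = w

  infixr 5 _∪ₛ_ _◂_

  _∪ₛ_ : (ℕ → A) → (ℕ → A) → ℕ → A
  v ∪ₛ w = ⋃ (either v w)

  ∈∪ˡ : ∀ v w {x} → Range v x → Range (v ∪ₛ w) x
  ∈∪ˡ v w = ∈⋃ (either v w) 0

  ∈∪ʳ : ∀ v w {x} → Range w x → Range (v ∪ₛ w) x
  ∈∪ʳ v w = ∈⋃ (either v w) 1

  _◂_ : List A → (ℕ → A) → ℕ → A
  ([] ◂ w) n            = w n
  ((x ∷ l) ◂ w) zero    = x
  ((x ∷ l) ◂ w) (suc n) = (l ◂ w) n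

  ∈◂ˡ : ∀ {l} w {x} → x ∈ˡ l → Range (l ◂ w) x
  ∈◂ˡ w (here refl) = 0 , refl
  ∈◂ˡ w (there x∈l) with n , p ← ∈◂ˡ w x∈l = suc n , p

  ∈◂ʳ : ∀ l w {x} → Range w x → Range (l ◂ w) x
  ∈◂ʳ []      w x∈w = x∈w
  ∈◂ʳ (y ∷ l) w x∈w with n , p ← ∈◂ʳ l w x∈w = suc n , p

  ∈◂⁻ : ∀ l w {x} → Range (l ◂ w) x → x ∈ˡ l ⊎ Range w x
  ∈◂⁻ []      w x∈        = inj₂ x∈
  ∈◂⁻ (y ∷ l) w (zero , p) = inj₁ (here (sym p))
  ∈◂⁻ (y ∷ l) w (suc n , p) with ∈◂⁻ l w (n , p)
  ... | inj₁ x∈l = inj₁ (there x∈l)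
  ... | inj₂ x∈w = inj₂ x∈w

  -- `unlist` runs through all lists of indices, so each stage adds the values of `op` at all finite
  -- lists over the previous one.
  module Closure (op : List A → ℕ → A) (w : ℕ → A) where

    stage : ℕ → ℕ → A
    stage zero    = w
    stage (suc k) = stage k ∪ₛ ⋃ λ n → op (map (stage k) (unlist n))

    closure : ℕ → A
    closure = ⋃ stage

    stage-+ : ∀ d k {x} → Range (stage k) x → Range (stage (d + k)) x
    stage-+ zero    k x∈ = x∈
    stage-+ (suc d) k x∈ = ∈∪ˡ _ _ (stage-+ d k x∈)

    ∈closure⁻ : ∀ {x} → Range closure x → ∃[ k ] Range (stage k) x
    ∈closure⁻ (n , p) = proj₁ (unpair n) , proj₂ (unpair n) , p

    base⊆closure : ∀ {x} → Range w x → Range closure x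
    base⊆closure = ∈⋃ stage 0

    common-stage : ∀ {l} → All (Range closure) l → ∃[ k ] All (Range (stage k)) l
    common-stage []       = 0 , []
    common-stage {x ∷ l} (x∈ ∷ l∈)
      with j , x∈j ← ∈closure⁻ x∈
      with k , l∈k ← common-stage l∈
      = j + k , subst (λ i → Range (stage i) x) (+-comm k j) (stage-+ k j x∈j) ∷ All.map (stage-+ j k) l∈k

    all-range : ∀ {v : ℕ → A} {l} → All (Range v) l → ∃[ l′ ] map v l′ ≡ l
    all-range []             = [] , refl
    all-range ((n , refl) ∷ l∈) with l′ , refl ← all-range l∈ = n ∷ l′ , refl

    -- The stages increase, so a finite list over the closure already lies over a single stage, and
    -- the next stage absorbs its image.
    closed : ∀ {l} → All (Range closure) l → ∀ n → Range closure (op l n)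
    closed l∈ n
      with k , l∈k ← common-stage l∈
      with l′ , refl ← all-range l∈k
      with c , refl ← unlist-surjective l′
      = ∈⋃ stage (suc k) (∈∪ʳ (stage k) _ (∈⋃ _ c (n , refl)))

module History {A : Set a} {P : ℕ → List A → A → Set b} (extend : ∀ n L → ∃[ x ] P n L x) where

  term    : ℕ → A
  history : ℕ → List A
  term n = proj₁ (extend n (history n))
  history zero    = []
  history (suc n) = term n ∷ history n

  term-spec : ∀ n → P n (history n) (term n)
  term-spec n = proj₂ (extend n (history n))

  earlier : ∀ {m n} → m <ℕ n → term m ∈ˡ history n
  earlier {m} {suc n} (s≤s m≤n) with m≤n⇒m<n∨m≡n m≤n
  ... | inj₁ m<n  = there (earlier m<n)
  ... | inj₂ refl = here refl

-- Walks and paths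

module Walks {ℓ : Level} (G : Graph ℓ) where
  open Graph G

  -- Repetitions are allowed, so walks compose freely. For `x` in `A`, `Walk A x` is the component
  -- of `x` in the subgraph induced on `A`.
  data Walk (A : Pred Vertex ℓ) : Rel Vertex ℓ where
    stop : ∀ {x} → A x → Walk A x x
    step : ∀ {x y z} → A x → Adj x y → Walk A y z → Walk A x z

  private
    variable
      A B S : Pred Vertex ℓ
      x y z : Vertex

  verts : Walk A x y → List Vertex
  verts {x = x} (stop _)     = x ∷ []
  verts {x = x} (step _ _ p) = x ∷ verts p

  source∈verts : (p : Walk A x y) → x ∈ˡ verts p
  source∈verts (stop _)     = here refl
  source∈verts (step _ _ p) = here refl

  target∈verts : (p : Walk A x y) → y ∈ˡ verts p
  target∈verts (stop _)     = here refl
  target∈verts (step _ _ p) = there (target∈verts p)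

  verts⊆ : (p : Walk A x y) → ∀ {v} → v ∈ˡ verts p → A v
  verts⊆ (stop a)     (here refl) = a
  verts⊆ (step a _ p) (here refl) = a
  verts⊆ (step a _ p) (there v∈)  = verts⊆ p v∈

  source∈ : Walk A x y → A x
  source∈ p = verts⊆ p (source∈verts p)

  target∈ : Walk A x y → A y
  target∈ p = verts⊆ p (target∈verts p)

  walk-map : (∀ {v} → A v → B v) → Walk A x y → Walk B x y
  walk-map f (stop a)       = stop (f a)
  walk-map f (step a adj p) = step (f a) adj (walk-map f p)

  infixr 5 _⊙_
  _⊙_ : Walk A x y → Walk A y z → Walk A x z
  stop _       ⊙ q = q
  step a adj p ⊙ q = step a adj (p ⊙ q)

  edge : A x → Adj x y → A y → Walk A x y
  edge a adj b = step a adj (stop b)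

  walk-sym : Walk A x y → Walk A y x
  walk-sym (stop a)       = stop a
  walk-sym (step a adj p) = walk-sym p ⊙ edge (source∈ p) (adj-sym adj) a

  within-verts : (p : Walk A x y) → ∀ {v} → v ∈ˡ verts p → Walk (_∈ˡ verts p) x v
  within-verts (stop a)       (here refl) = stop (here refl)
  within-verts (step a adj p) (here refl) = stop (here refl)
  within-verts (step a adj p) (there v∈)  = step (here refl) adj (walk-map there (within-verts p v∈))

  Connects : Vertex → List Vertex → Set ℓ
  Connects x l = ∀ {v} → v ∈ˡ l → Walk (_∈ˡ l) x v

  connects-++ : ∀ {x} l {l′} → Connects x l → Connects x l′ → Connects x (l ++ l′)
  connects-++ l {l′} con con′ v∈ with ∈-++⁻ l v∈
  ... | inj₁ v∈l  = walk-map (∈-++⁺ˡ {xs = l} {ys = l′}) (con v∈l)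
  ... | inj₂ v∈l′ = walk-map (∈-++⁺ʳ l) (con′ v∈l′)

  -- The walk is split where it first leaves `B`; the part after the crossing may return to `B`.
  record Exit (A B : Pred Vertex ℓ) (x y : Vertex) : Set ℓ where
    field
      {inner outer} : Vertex
      before        : Walk (λ v → A v × B v) x inner
      crossing      : Adj inner outer
      outside       : ¬ B outer
      after         : Walk A outer y

  stay-or-exit : Decidable B → Walk A x y → B x → Walk (λ v → A v × B v) x y ⊎ Exit A B x y
  stay-or-exit B? (stop a) b = inj₁ (stop (a , b))
  stay-or-exit {B = B} B? (step {y = w} a adj p) b with B? w
  ... | no ¬b = inj₂ record { before = stop (a , b) ; crossing = adj ; outside = ¬b ; after = p }
  ... | yes b′ with stay-or-exit B? p b′
  ...   | inj₁ q = inj₁ (step (a , b) adj q)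
  ...   | inj₂ e = inj₂ record { before = step (a , b) adj (Exit.before e) ; Exit e }

  exit : Decidable B → Walk A x y → B x → ¬ B y → Exit A B x y
  exit B? p b ¬b with stay-or-exit B? p b
  ... | inj₁ q = ⊥-elim (¬b (proj₂ (target∈ q)))
  ... | inj₂ e = e

  module _ (_≟_ : DecidableEquality Vertex) where

    -- Following the last visit of the walk to w.
    leave : ∀ {w} → Walk A x y → y ≢ w →
            Walk (λ v → A v × v ≢ w) x y ⊎ ∃[ z ] Adj w z × Walk (λ v → A v × v ≢ w) z y
    leave (stop a) y≢w = inj₁ (stop (a , y≢w))
    leave {x = x} {w = w} (step a adj p) y≢w with leave p y≢w
    ... | inj₂ e = inj₂ e
    ... | inj₁ q with x ≟ w
    ...   | yes refl = inj₂ (_ , adj , q)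
    ...   | no x≢w   = inj₁ (step (a , x≢w) adj q)

    leave-source : Walk A x y → y ≢ x → ∃[ z ] Adj x z × Walk (λ v → A v × v ≢ x) z y
    leave-source p y≢x with leave p y≢x
    ... | inj₁ q = ⊥-elim (proj₂ (source∈ q) refl)
    ... | inj₂ e = e

  len : Walk A x y → ℕ
  len (stop _)     = 0
  len (step _ _ p) = suc (len p)

  at : (p : Walk A x y) → Fin (suc (len p)) → Vertex
  at {x = x} (stop _)     _        = x
  at {x = x} (step _ _ p) zero     = x
  at         (step _ _ p) (suc i)  = at p i

  at-zero : (p : Walk A x y) → at p zero ≡ x
  at-zero (stop _)     = refl
  at-zero (step _ _ p) = refl

  at-last : (p : Walk A x y) → at p (fromℕ (len p)) ≡ y
  at-last (stop _)     = refl
  at-last (step _ _ p) = at-last p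

  at∈verts : (p : Walk A x y) → ∀ i → at p i ∈ˡ verts p
  at∈verts (stop _)     _       = here refl
  at∈verts (step _ _ p) zero    = here refl
  at∈verts (step _ _ p) (suc i) = there (at∈verts p i)

  at-adjacent : (p : Walk A x y) → ∀ i → Adj (at p (inject₁ i)) (at p (suc i))
  at-adjacent (step _ adj p) zero    = subst (Adj _) (sym (at-zero p)) adj
  at-adjacent (step _ _ p)   (suc i) = at-adjacent p i

  -- Simple, and meeting B at most in its target.
  Clean : Pred Vertex ℓ → Walk A x y → Set ℓ
  Clean         B (stop _)             = Lift ℓ ⊤
  Clean {x = x} B (step _ _ p) = x ∉ˡ verts p × ¬ B x × Clean B p

  at-injective : (p : Walk A x y) → Clean B p → ∀ {i j} → at p i ≡ at p j → i ≡ j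
  at-injective (stop _)     _            {zero}  {zero}  _  = refl
  at-injective (step _ _ p) _            {zero}  {zero}  _  = refl
  at-injective (step _ _ p) (x∉p , _)    {zero}  {suc j} eq = ⊥-elim (x∉p (subst (_∈ˡ verts p) (sym eq) (at∈verts p j)))
  at-injective (step _ _ p) (x∉p , _)    {suc i} {zero}  eq = ⊥-elim (x∉p (subst (_∈ˡ verts p) eq (at∈verts p i)))
  at-injective (step _ _ p) (_ , _ , cl) {suc i} {suc j} eq = cong suc (at-injective p cl eq)

  clean-path : (p : Walk A x y) → Clean B p → Path G
  clean-path p cl = record
    { length    = len p
    ; vertex    = at p
    ; injective = at-injective p cl
    ; adjacent  = at-adjacent p
    }

  clean-target : (p : Walk A x y) → Clean B p → ∀ {v} → v ∈ˡ verts p → B v → v ≡ y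
  clean-target (stop _)     _             (here refl) _ = refl
  clean-target (step _ _ p) (_ , ¬b , _)  (here refl) b = ⊥-elim (¬b b)
  clean-target (step _ _ p) (_ , _  , cl) (there v∈)  b = clean-target p cl v∈ b

  suffix : (p : Walk A x y) → Clean B p → ∀ {v} → v ∈ˡ verts p → Σ[ q ∈ Walk A v y ] Clean B q
  suffix p@(stop _)     cl            (here refl) = p , cl
  suffix p@(step _ _ _) cl            (here refl) = p , cl
  suffix (step _ _ p)   (_ , _ , cl)  (there v∈)  = suffix p cl v∈

  TailAvoids : Pred Vertex ℓ → Walk A x y → Set ℓ
  TailAvoids S (stop _)     = Lift ℓ ⊤
  TailAvoids S (step _ _ p) = ∀ {v} → v ∈ˡ verts p → ¬ S v

  tail-source : (p : Walk A x y) → TailAvoids S p → ∀ {v} → v ∈ˡ verts p → S v → v ≡ x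
  tail-source (stop _)     _     (here refl) _ = refl
  tail-source (step _ _ p) _     (here refl) _ = refl
  tail-source (step _ _ p) avoid (there v∈)  s = ⊥-elim (avoid v∈ s)

  module _ (dec : ∀ (P : Set ℓ) → Dec P) where

    clean : Walk A x y → B y → ∃[ z ] B z × Σ[ q ∈ Walk A x z ] Clean B q
    clean (stop a) b = _ , b , stop a , lift tt
    clean {x = x} {B = B} (step a adj p) b with dec (B x)
    ... | yes bx = x , bx , stop a , lift tt
    ... | no ¬bx
      with z , bz , q , cl ← clean p b
      with dec (x ∈ˡ verts q)
    ...   | yes x∈q = z , bz , suffix q cl x∈q
    ...   | no  x∉q = z , bz , step a adj q , x∉q , ¬bx , cl

    last-in : (p : Walk A x y) → Clean B p → ∃[ v ] v ∈ˡ verts p × S v →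
              ∃[ v ] S v × Σ[ q ∈ Walk A v y ] Clean B q × TailAvoids S q
    last-in p@(stop _) cl (_ , here refl , s) = _ , s , p , cl , lift tt
    last-in {S = S} p@(step _ _ p′) cl (v , v∈ , s) with dec (∃[ u ] u ∈ˡ verts p′ × S u)
    ... | yes later = last-in p′ (proj₂ (proj₂ cl)) later
    ... | no  none with v∈
    ...   | here refl = _ , s , p , cl , λ u∈ s′ → none (_ , u∈ , s′)
    ...   | there v∈p′ = ⊥-elim (none (_ , v∈p′ , s))

    record PathIn (A S B : Pred Vertex ℓ) : Set ℓ where
      field
        path     : Path G
        inside   : ∀ {v} → OnPath path v → A v
        starts   : S (Path.start path)
        ends     : B (Path.end path)
        at-start : ∀ {v} → OnPath path v → S v → Path.start path ≡ v
        at-end   : ∀ {v} → OnPath path v → B v → Path.end path ≡ v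

    -- `clean` cuts the walk at its first vertex in `B` and removes repetitions; `last-in` then
    -- drops everything before the last vertex in `S`. The result need not have least length.
    shortest : Walk A x y → S x → B y → PathIn A S B
    shortest {A = A} {S = S} {B = B} p s b
      with z , bz , q , cl ← clean {B = B} p b
      with v , sv , r , clr , tail ← last-in {S = S} q cl (_ , source∈verts q , s)
      = record
      { path     = clean-path r clr
      ; inside   = λ on → verts⊆ r (on-verts r on)
      ; starts   = subst S (sym (at-zero r)) sv
      ; ends     = subst B (sym (at-last r)) bz
      ; at-start = λ on s′ → trans (at-zero r) (sym (tail-source r tail (on-verts r on) s′))
      ; at-end   = λ on b′ → trans (at-last r) (sym (clean-target r clr (on-verts r on) b′))
      }
      where
      on-verts : ∀ {x y} (r : Walk A x y) {v} → ∃[ i ] at r i ≡ v → v ∈ˡ verts r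
      on-verts r (i , refl) = at∈verts r i

  walk-along : ∀ n (f : Fin (suc n) → Vertex) → (∀ i → Adj (f (inject₁ i)) (f (suc i))) →
               (∀ i → A (f i)) → Walk A (f zero) (f (fromℕ n))
  walk-along zero    f adj a = stop (a zero)
  walk-along (suc n) f adj a = step (a zero) (adj zero) (walk-along n (f ∘ suc) (adj ∘ suc) (a ∘ suc))

  path-walk : (p : Path G) → (∀ {v} → OnPath p v → A v) → Walk A (Path.start p) (Path.end p)
  path-walk p a = walk-along (Path.length p) (Path.vertex p) (Path.adjacent p) λ i → a (i , refl)

  ray-walk : (r : Ray G) → (∀ n → A (Ray.vertex r n)) → ∀ m n → Walk A (Ray.vertex r m) (Ray.vertex r n)
  ray-walk {A = A} r a m n = walk-sym (from-origin m) ⊙ from-origin n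
    where
    from-origin : ∀ n → Walk A (Ray.vertex r 0) (Ray.vertex r n)
    from-origin zero    = stop (a 0)
    from-origin (suc n) = from-origin n ⊙ edge (a n) (Ray.adjacent r n) (a (suc n))

-- Classical logic and countability

module _ (em : ∀ {a} → ExcludedMiddle a) where

  -- Excluded middle holds for every type, not only for propositions, so this
  -- is a global choice operator.
  dne : {A : Set a} → ¬ ¬ A → A
  dne = em⇒dne em

  recompute′ : {A : Set a} → .A → A
  recompute′ = recompute em

  ¬∀⇒∃¬ : {A : Set a} {B : A → Set b} → ¬ (∀ x → B x) → ∃[ x ] ¬ B x
  ¬∀⇒∃¬ ¬all = dne λ none → ¬all λ x → dne λ ¬b → none (x , ¬b)

  enumeration⇒countable : {A : Set a} (e : ℕ → A) → (∀ x → Range e x) → Countable A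
  enumeration⇒countable e e-onto =
    mk↣ {to = λ x → proj₁ (e-onto x)} λ {x} {y} eq →
      trans (sym (proj₂ (e-onto x))) (trans (cong e eq) (proj₂ (e-onto y)))

  countable⇒enumeration : {A : Set a} → A → Countable A → Σ[ e ∈ (ℕ → A) ] ∀ x → Range e x
  countable⇒enumeration {A = A} x₀ c = e , onto
    where
    open Injection c
    pick : ∀ n → Dec (∃[ x ] to x ≡ n) → A
    pick n (yes (x , _)) = x
    pick n (no _)        = x₀
    e : ℕ → A
    e n = pick n em
    onto : ∀ x → Range e x
    onto x = to x , pick-onto em
      where
      pick-onto : (d : Dec (∃[ y ] to y ≡ to x)) → pick (to x) d ≡ x
      pick-onto (yes (y , p)) = injective p
      pick-onto (no none)     = ⊥-elim (none (x , refl))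

  -- The index comes from `recompute′`, so it depends on the element alone and not on the irrelevant
  -- proof of membership.
  Range-countable : {A : Set a} (e : ℕ → A) → CountableSubset (Range e)
  Range-countable e = mk↣ {to = λ (_ , [ p ]) → proj₁ (recompute′ p)} λ { {_ , [ p ]} {_ , [ q ]} eq →
    value-injective (trans (sym (proj₂ (recompute′ p))) (trans (cong e eq) (proj₂ (recompute′ q)))) }

  subset-enumeration : {A : Set a} (S : Pred A a) → A → CountableSubset S →
                       Σ[ e ∈ (ℕ → A) ] ∀ x → S x → Range e x
  subset-enumeration {A = A} S x₀ countable with em {P = [ x ∈ A ∣ S x ]}
  ... | no empty = (λ _ → x₀) , λ x x∈S → ⊥-elim (empty (x , [ x∈S ]))
  ... | yes x₁ with e , onto ← countable⇒enumeration x₁ countable =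
    value ∘ e , λ x x∈S → let n , p = onto (x , [ x∈S ]) in n , cong value p

  EventuallyMisses : {V : Set a} → (ℕ → Pred V b) → List V → Set _
  EventuallyMisses B F = ∃[ N ] (∀ {n} → N ≤ n → ∀ {v} → v ∈ˡ F → ¬ B n v)

  -- Each vertex of the finite list `F` lies in at most one of the disjoint sets, so `F` meets only
  -- finitely many of them.
  eventually-misses : {V : Set a} (B : ℕ → Pred V b) → (∀ {m n} → m <ℕ n → ∀ {v} → B m v → ¬ B n v) →
                      ∀ F → EventuallyMisses B F
  eventually-misses B disjoint []      = 0 , λ _ ()
  eventually-misses B disjoint (x ∷ F) with eventually-misses B disjoint F | em {P = ∃[ m ] B m x}
  ... | N , misses | no never = N , λ
    { N≤n (here refl) Bnx → never (_ , Bnx)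
    ; N≤n (there v∈F)     → misses N≤n v∈F
    }
  ... | N , misses | yes (m , Bmx) = N + suc m , λ
    { N≤n (here refl) → disjoint (≤-trans (m≤n+m (suc m) N) N≤n) Bmx
    ; N≤n (there v∈F) → misses (≤-trans (m≤m+n N (suc m)) N≤n) v∈F
    }

  -- Recursion along ω₁

  module Omega₁ (ext : ∀ {a b} → Extensionality a b)
                {κ : Set ℓ} {_<_ : Rel κ ℓ} (isOmega₁ : IsOmega₁ _<_) where

    <-isStrictTotalOrder = proj₁ isOmega₁
    <-wellFounded        = proj₁ (proj₂ isOmega₁)
    uncountable          = proj₁ (proj₂ (proj₂ isOmega₁))
    segment-countable    = proj₂ (proj₂ (proj₂ isOmega₁))

    open IsStrictTotalOrder <-isStrictTotalOrder using (compare; irrefl) public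

    abstract
      κ-element : κ
      κ-element = dne λ empty → uncountable (mk↣ {to = λ x → ⊥-elim (empty x)} λ {x} → ⊥-elim (empty x))

      another-element : ∀ (o : κ) → ∃[ x ] x ≢ o
      another-element o = ¬∀⇒∃¬ λ all≡o → uncountable (mk↣ {to = λ _ → 0} λ {x} {y} _ → trans (all≡o x) (sym (all≡o y)))

    module Greedy {A : Set a} {R : Rel A b} (a₀ : A)
                  (extend : ∀ (g : ℕ → A) → Σ[ x ∈ A ] ∀ n → R (g n) x) where

      code : ∀ {y x} → y < x → ℕ
      code {y} {x} y<x = Injection.to (segment-countable x) (y , [ y<x ])

      At : κ → ℕ → Set _
      At x n = Σ[ y ∈ κ ] Σ[ y<x ∈ y < x ] code y<x ≡ n

      value-at : ∀ {x n} → WfRec _<_ (λ _ → A) x → Dec (At x n) → A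
      value-at h (yes (_ , y<x , _)) = h y<x
      -- Numbers that code no predecessor are filled in with `a₀`, so that `extend` receives a total
      -- sequence.
      value-at h (no _)              = a₀

      enumerate : ∀ x → WfRec _<_ (λ _ → A) x → ℕ → A
      enumerate x h n = value-at h (em {P = At x n})

      value-at-ext : ∀ {x n} {h h′ : WfRec _<_ (λ _ → A) x} → (∀ {y} y<x → h {y} y<x ≡ h′ y<x) →
                     (d : Dec (At x n)) → value-at h d ≡ value-at h′ d
      value-at-ext h≡h′ (yes (_ , y<x , _)) = h≡h′ y<x
      value-at-ext h≡h′ (no _)              = refl

      body : ∀ x → WfRec _<_ (λ _ → A) x → A
      body x h = proj₁ (extend (enumerate x h))

      body-ext : ∀ x {h h′ : WfRec _<_ (λ _ → A) x} → (∀ {y} y<x → h {y} y<x ≡ h′ y<x) → body x h ≡ body x h′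
      body-ext x {h} {h′} h≡h′ = cong (proj₁ ∘ extend) (ext λ n → value-at-ext {h = h} {h′ = h′} h≡h′ em)

      open FixPoint <-wellFounded (λ _ → A) body body-ext using (unfold-wfRec)

      family : κ → A
      family = All.wfRec <-wellFounded _ (λ _ → A) body

      value-at-code : ∀ {β α} (β<α : β < α) (d : Dec (At α (code β<α))) →
                      value-at (λ {y} _ → family y) d ≡ family β
      value-at-code β<α (yes (y , y<α , p)) =
        cong (family ∘ value) (Injection.injective (segment-countable _) p)
      value-at-code β<α (no none) = ⊥-elim (none (_ , β<α , refl))

      related : ∀ {β α} → β < α → R (family β) (family α)
      related {β} {α} β<α =
        subst (R (family β)) (sym unfold-wfRec)
          (subst (λ x → R x _) (value-at-code β<α em)
            (proj₂ (extend (enumerate α λ {y} _ → family y)) (code β<α)))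

    opaque
      -- Initial segments are countable, so the values chosen so far form a sequence, and `extend`
      -- supplies a value related to all of them.
      greedy : {A : Set a} (R : Rel A b) → A →
               (∀ (g : ℕ → A) → Σ[ x ∈ A ] ∀ n → R (g n) x) →
               Σ[ f ∈ (κ → A) ] (∀ {β α} → β < α → R (f β) (f α))
      greedy R a₀ extend = Greedy.family {R = R} a₀ extend , Greedy.related {R = R} a₀ extend

    ≢⇒related : ∀ {P : κ → κ → Set a} → (∀ {β α} → β < α → P β α) → (∀ {β α} → P β α → P α β) →
                ∀ {α β} → α ≢ β → P α β
    ≢⇒related <⇒P P-sym {α} {β} α≢β with compare α β
    ... | tri< α<β _ _ = <⇒P α<β
    ... | tri≈ _ α≡β _ = ⊥-elim (α≢β α≡β)
    ... | tri> _ _ β<α = P-sym (<⇒P β<α)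

    Disjoint : {V : Set a} → (κ → Pred V b) → Set _
    Disjoint S = ∀ {α β} → α ≢ β → ∀ x → S α x → ¬ S β x

    opaque
      -- Otherwise choosing a hit for each `α` would inject `κ` into `ℕ`, since each `w n` lies in
      -- at most one of the disjoint sets.
      avoiding : {V : Set a} (S : κ → Pred V b) → Disjoint S → (w : ℕ → V) → ∃[ α ] ∀ n → ¬ S α (w n)
      avoiding S disjoint w = dne λ none →
        let hit : ∀ α → ∃[ n ] S α (w n)
            hit α = dne λ misses → none (α , λ n Sαn → misses (n , Sαn))
        in uncountable (mk↣ {to = λ α → proj₁ (hit α)} λ {α} {β} eq → dne λ α≢β →
             disjoint α≢β _ (proj₂ (hit α)) (subst (S β ∘ w) (sym eq) (proj₂ (hit β))))

    -- The degree is a supremum, so attainment has to be shown. If all disjoint families were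
    -- countable, `ℕ` would bound them and `κ` would embed in it. From an uncountable family
    -- `greedy` picks distinct members indexed by `κ`.
    degree-family : {G : Graph ℓ} (ε : End G) → HasDegree ε κ →
                    Σ[ t ∈ (κ → Ray G) ] DisjointFamilyIn ε t
    degree-family {G} ε (_ , least) =
      (λ α → R (f α)) , (λ α → R∈ε (f α)) ,
      λ α≢β v v∈α v∈β → R-disjoint (≢⇒related {P = λ α β → f α ≢ f β} f-fresh (λ p q → p (sym q)) α≢β) v v∈α v∈β
      where
      Uncountable : Set _
      Uncountable = Σ[ I ∈ Set ℓ ] Σ[ R ∈ (I → Ray G) ] DisjointFamilyIn ε R × ¬ Countable I
      uncountable-family : Uncountable
      uncountable-family = dne λ none →
        let κ↣ℕ = least (Lift ℓ ℕ) λ I R R-disjoint →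
              let c = dne λ ¬c → none (I , R , R-disjoint , ¬c)
              in mk↣ {to = λ i → lift (Injection.to c i)} λ eq → Injection.injective c (lift-injective eq)
        in uncountable (mk↣ {to = λ x → lower (Injection.to κ↣ℕ x)} λ eq → Injection.injective κ↣ℕ (cong lift eq))
        where
        lift-injective : ∀ {m n : ℕ} → lift {ℓ = ℓ} m ≡ lift n → m ≡ n
        lift-injective = cong lower
      I = proj₁ uncountable-family
      R = proj₁ (proj₂ uncountable-family)
      R∈ε = proj₁ (proj₁ (proj₂ (proj₂ uncountable-family)))
      R-disjoint : PairwiseDisjoint R
      R-disjoint = proj₂ (proj₁ (proj₂ (proj₂ uncountable-family)))
      ¬countable = proj₂ (proj₂ (proj₂ uncountable-family))
      fresh : ∀ (g : ℕ → I) → ∃[ i ] ∀ n → g n ≢ i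
      fresh g = dne λ none → ¬countable (enumeration⇒countable g λ i → dne λ i∉g → none (i , λ n p → i∉g (n , p)))
      family = greedy {A = I} _≢_ (dne λ empty → ¬countable (mk↣ {to = λ i → ⊥-elim (empty i)} λ {i} → ⊥-elim (empty i))) fresh
      f = proj₁ family
      f-fresh : ∀ {β α} → β < α → f β ≢ f α
      f-fresh = proj₂ family

  -- Reaching `r₀` and closed hulls

  module _ (ext : ∀ {a b} → Extensionality a b)
           {κ : Set ℓ} {_<_ : Rel κ ℓ} (isOmega₁ : IsOmega₁ _<_)
           {G : Graph ℓ} (ε : End G)
           (t : κ → Ray G) (t-family : DisjointFamilyIn ε t)
           (r₀ : Ray G) (r₀∈ε : r₀ ∈ End.rays ε) where

    open Graph G
    open Walks G
    open Omega₁ ext isOmega₁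
    open Ray using (vertex)

    t∈ε        = proj₁ t-family
    t-disjoint = proj₂ t-family

    decide : ∀ (P : Pred Vertex ℓ) → Decidable P
    decide P v = em

    Avoids : List Vertex → Pred Vertex ℓ
    Avoids F v = v ∉ˡ F

    Reach : Pred Vertex ℓ → Pred Vertex ℓ
    Reach A x = ∃[ n ] Walk A x (vertex r₀ n)

    reach-map : ∀ {A B : Pred Vertex ℓ} {x} → (∀ {v} → A v → B v) → Reach A x → Reach B x
    reach-map f (n , p) = n , walk-map f p

    infixr 5 _⊙ʳ_
    _⊙ʳ_ : ∀ {A : Pred Vertex ℓ} {x y} → Walk A x y → Reach A y → Reach A x
    p ⊙ʳ (n , q) = n , p ⊙ q

    end-reach : ∀ {r} → r ∈ End.rays ε → ∀ F → ∃[ k ] Reach (Avoids F) (vertex r k)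
    end-reach {r} r∈ε F
      with p , ¬meets ← ¬∀⇒∃¬ (Equivalence.to (End.class ε r∈ε r₀) r₀∈ε F)
      with (k , k≡) , ¬meets₁ ← ¬∀⇒∃¬ ¬meets
      with (n , n≡) , ¬meets₂ ← ¬∀⇒∃¬ ¬meets₁
      = k , n , subst₂ (Walk (Avoids F)) (sym k≡) (sym n≡)
                  (path-walk p λ {v} on v∈F → ¬meets₂ (v , on , v∈F))

    reach-end : ∀ {r} → (∀ F → ∃[ k ] Reach (Avoids F) (vertex r k)) → r ∈ End.rays ε
    reach-end {r} reach = Equivalence.from (End.class ε r₀∈ε r) λ F separates →
      let k , n , p = reach F
          open PathIn (shortest (λ P → em {P = P}) {S = OnRay r₀} {B = OnRay r} (walk-sym p) (n , refl) (k , refl))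
          v , on , v∈F = separates path starts ends
      in inside on v∈F

    record StarFamily : Set ℓ where
      field
        ray       : κ → Ray G
        ray∈ε     : ∀ α → ray α ∈ End.rays ε
        disjoint  : ∀ {α β} → α ≢ β → ∀ m n → vertex (ray α) m ≢ vertex (ray β) n
        off-r₀    : ∀ α m n → vertex (ray α) m ≢ vertex r₀ n
        reach     : ∀ α F → ∃[ k ] Reach (λ v → v ∉ˡ F × (∀ {β} → β ≢ α → ¬ OnRay (ray β) v)) (vertex (ray α) k)

    record Closed (z : ℕ → Vertex) : Set ℓ where
      field
        r₀⊆     : ∀ n → Range z (vertex r₀ n)
        reroute : ∀ {u} F → Range z u → Reach (Avoids F) u → Reach (λ v → Range z v × v ∉ˡ F) u

    -- `extra` attaches to each vertex a countable set that the hull must absorb as well; for the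
    -- core these are the separators of the cut families.
    record ClosedHull (extra : Vertex → ℕ → Vertex) (w : ℕ → Vertex) : Set ℓ where
      field
        hull    : ℕ → Vertex
        base⊆   : ∀ {v} → Range w v → Range hull v
        closed  : Closed hull
        extra⊆  : ∀ {u} → Range hull u → ∀ {v} → Range (extra u) v → Range hull v

    module _ (extra : Vertex → ℕ → Vertex) (w : ℕ → Vertex) where
      private
        detour : ∀ {F u} → Dec (Reach (Avoids F) u) → List Vertex
        detour (yes (_ , p)) = verts p
        detour (no _)        = []

        -- The list `u ∷ F` requests a detour from `u` to `r₀` outside `F`, if there is one; the
        -- empty list brings in `r₀`.
        op : List Vertex → ℕ → Vertex
        op []      = vertex r₀
        op (u ∷ F) = detour {F} {u} em ◂ extra u

        open Closure op w using (closure; base⊆closure) renaming (closed to op-closed)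

        inside? : Decidable (Range closure)
        inside? v = em

        detour-reach : ∀ {F u} → Reach (Avoids F) u → (d : Dec (Reach (Avoids F) u)) →
                       Reach (λ v → v ∈ˡ detour d × v ∉ˡ F) u
        detour-reach _ (yes (n , p)) = n , walk-map (λ v∈ → v∈ , verts⊆ p v∈) (within-verts p (target∈verts p))
        detour-reach r (no ¬r)       = ⊥-elim (¬r r)

        op-closed′ : ∀ {L} → All (Range closure) L → ∀ {v} → Range (op L) v → Range closure v
        op-closed′ L∈ (n , refl) = op-closed L∈ n

      opaque
        closedHull : ClosedHull extra w
        closedHull = record
          { hull   = closure
          ; base⊆  = base⊆closure
          ; closed = record
            { r₀⊆     = op-closed []
            -- Only lists inside the closure are served, so the detour is requested for the part of
            -- `F` in the closure. The detour lies in the closure and therefore avoids the rest of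
            -- `F` too.
            ; reroute = λ {u} F u∈ r → reach-map
                (λ (v∈d , v∉F) →
                  let v∈ = op-closed′ (u∈ ∷ all-filter inside? F) (∈◂ˡ (extra u) v∈d)
                  in v∈ , λ v∈F → v∉F (∈-filter⁺ inside? v∈F v∈))
                (detour-reach (reach-map (λ v∉F v∈ → v∉F (proj₁ (∈-filter⁻ inside? v∈))) r) em)
            }
          ; extra⊆ = λ {u} u∈ v∈ → op-closed′ (u∈ ∷ []) (∈◂ʳ (detour {[]} {u} em) (extra u) v∈)
          }

    hull-of : ∀ w → ClosedHull (λ _ → vertex r₀) w
    hull-of = closedHull (λ _ → vertex r₀)

    -- Components of `G - z`

    Outside : (ℕ → Vertex) → Pred Vertex ℓ
    Outside z v = ¬ Range z v

    -- (z, i) stands for the component of G - z containing the ray t i.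
    record Node : Set ℓ where
      field
        hull   : ℕ → Vertex
        closed : Closed hull
        index  : κ
        avoids : ∀ n → Outside hull (vertex (t index) n)

      base : Vertex
      base = vertex (t index) 0

      Comp : Pred Vertex ℓ
      Comp = Walk (Outside hull) base

      open Closed closed public

      ray⊆Comp : ∀ n → Comp (vertex (t index) n)
      ray⊆Comp = ray-walk (t index) avoids 0

      base∈Comp : Comp base
      base∈Comp = ray⊆Comp 0

      boundary : ∀ {x y} → Comp x → Adj x y → ¬ Comp y → Range hull y
      boundary x∈ adj y∉ = dne λ y∉z → y∉ (x∈ ⊙ edge (target∈ x∈) adj y∉z)

      comp-inside : ∀ {x y} → Comp x → Walk (Outside hull) x y → Walk Comp x y
      comp-inside x∈ (stop _)       = stop x∈
      comp-inside x∈ (step a adj p) = step x∈ adj (comp-inside (x∈ ⊙ edge a adj (source∈ p)) p)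

    open Node

    -- Uncountably many disjoint components

    module ManyComponents (f : κ → Node) (f-disjoint : Disjoint (Comp ∘ f)) where

      -- The base is listed besides the hull to make the thinned indices distinct: a base lies in
      -- its own component.
      Clear : Rel κ ℓ
      Clear β α = ∀ v → v ≡ base (f β) ⊎ Range (hull (f β)) v → ¬ Comp (f α) v

      opaque
        thinning : Σ[ g ∈ (κ → κ) ] (∀ {β α} → β < α → Clear (g β) (g α))
        thinning = greedy Clear κ-element λ g →
          let w n = (base (f (g n)) ∷ []) ◂ hull (f (g n))
              α , misses = avoiding (Comp ∘ f) f-disjoint (⋃ w)
              clear : ∀ n v → v ≡ base (f (g n)) ⊎ Range (hull (f (g n))) v → ¬ Comp (f α) v
              clear n = λ
                { v (inj₁ refl) v∈α → missed misses (∈⋃ w n (∈◂ˡ (hull (f (g n))) (here refl))) v∈α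
                ; v (inj₂ v∈z)  v∈α → missed misses (∈⋃ w n (∈◂ʳ (base (f (g n)) ∷ []) _ v∈z)) v∈α
                }
          in α , clear
          where
          missed : ∀ {w α} → (∀ n → ¬ Comp (f α) (w n)) → ∀ {v} → Range w v → ¬ Comp (f α) v
          missed misses (n , refl) = misses n

      g = proj₁ thinning

      N : κ → Node
      N α = f (g α)

      hull-clear : ∀ {β α} → β < α → ∀ {v} → Range (hull (N β)) v → ¬ Comp (N α) v
      hull-clear β<α v∈ = proj₂ thinning β<α _ (inj₂ v∈)

      own-clear : ∀ {α v} → Range (hull (N α)) v → ¬ Comp (N α) v
      own-clear v∈ v∈α = target∈ v∈α v∈

      N-disjoint : Disjoint (Comp ∘ N)
      N-disjoint α≢β = f-disjoint
        (≢⇒related {P = λ α β → g α ≢ g β}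
          (λ {β} {α} β<α gβ≡gα → proj₂ thinning β<α _ (inj₁ refl) (subst (λ γ → Comp (f γ) (base (N β))) gβ≡gα (base∈Comp (N β))))
          (λ p q → p (sym q)) α≢β)

      Off : Pred Vertex ℓ
      Off v = ∀ α → ¬ Comp (N α) v

      -- A walk inside the hull of N α can only run into components of
      -- smaller index; just before it does so it is in the hull of that
      -- smaller index.
      reach-off : ∀ α u F → Range (hull (N α)) u → Off u → Reach (Avoids F) u →
                  Reach (λ v → v ∉ˡ F × Off v) u
      reach-off = All.wfRec <-wellFounded _ _ λ α IH u F u∈ off r → go α IH F off (reroute (N α) F u∈ r)
        where
        go : ∀ α → (∀ {β} → β < α → ∀ u F → Range (hull (N β)) u → Off u → Reach (Avoids F) u →
                    Reach (λ v → v ∉ˡ F × Off v) u) →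
             ∀ {u} F → Off u → Reach (λ v → Range (hull (N α)) v × v ∉ˡ F) u →
             Reach (λ v → v ∉ˡ F × Off v) u
        go α IH F off (n , p) with stay-or-exit (decide Off) p off
        ... | inj₁ q = n , walk-map (λ ((_ , v∉F) , off-v) → v∉F , off-v) q
        ... | inj₂ e
          with β , ¬¬v∈β ← ¬∀⇒∃¬ (Exit.outside e)
          with compare β α
        -- The vertex just entered lies in the hull of `N α`, which misses the components of `N α`
        -- and of all larger indices.
        ...   | tri≈ _ refl _ = ⊥-elim (own-clear (proj₁ (source∈ (Exit.after e))) (dne ¬¬v∈β))
        ...   | tri> _ _ α<β  = ⊥-elim (hull-clear α<β (proj₁ (source∈ (Exit.after e))) (dne ¬¬v∈β))
        ...   | tri< β<α _ _  =
          walk-map (λ ((_ , v∉F) , off-v) → v∉F , off-v) before ⊙ʳ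
          IH β<α inner F (boundary (N β) (dne ¬¬v∈β) (adj-sym crossing) (inner-off β)) inner-off
             (n , step (proj₂ (proj₁ (target∈ before))) crossing (walk-map proj₂ after))
          where
          open Exit e
          inner-off : Off inner
          inner-off = proj₂ (target∈ before)

      starFamily : StarFamily
      starFamily = record
        { ray      = λ α → t (index (N α))
        ; ray∈ε    = λ α → t∈ε (index (N α))
        ; disjoint = λ {α} {β} α≢β m n eq →
            N-disjoint α≢β _ (ray⊆Comp (N α) m) (subst (Comp (N β)) (sym eq) (ray⊆Comp (N β) n))
        ; off-r₀   = λ α m n eq → avoids (N α) m (subst (Range (hull (N α))) (sym eq) (r₀⊆ (N α) n))
        ; reach    = reach
        }
        where
        reach : ∀ α F → ∃[ k ] Reach (λ v → v ∉ˡ F × (∀ {β} → β ≢ α → ¬ OnRay (t (index (N β))) v)) (vertex (t (index (N α))) k)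
        -- Inside its own component the walk misses the other rays. The first vertex beyond lies in
        -- the hull of `N α`, where `reach-off` takes over.
        reach α F with k , n , p ← end-reach (t∈ε (index (N α))) F =
          k , walk-map (λ (v∉F , v∈α) → v∉F , λ β≢α on → N-disjoint β≢α _ (on-comp on) v∈α) before ⊙ʳ
              step (proj₁ (target∈ before) , λ β≢α on → N-disjoint β≢α _ (on-comp on) inner∈) crossing (stop outer-ok) ⊙ʳ
              reach-map (λ (v∉F , off) → v∉F , λ {β} _ on → off β (on-comp on))
                (reach-off α outer F outer∈ outer-off (n , after))
          where
          on-comp : ∀ {β v} → OnRay (t (index (N β))) v → Comp (N β) v
          on-comp {β} (m , refl) = ray⊆Comp (N β) m
          open Exit (exit (decide (Comp (N α))) p (ray⊆Comp (N α) k) (own-clear (r₀⊆ (N α) n)))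
          inner∈ = proj₂ (target∈ before)
          outer∈ : Range (hull (N α)) outer
          outer∈ = boundary (N α) inner∈ crossing outside
          outer-off : Off outer
          outer-off β outer∈β with compare β α
          ... | tri≈ _ refl _ = outside outer∈β
          ... | tri> _ _ α<β  = hull-clear α<β outer∈ outer∈β
          -- If `outer` lay in the component of `N β`, then `inner`, being in that of `N α`, would
          -- lie in the hull of `N β`, against the thinning.
          ... | tri< β<α _ _  =
            hull-clear β<α (boundary (N β) outer∈β (adj-sym crossing) λ inner∈β → N-disjoint (λ { refl → irrefl refl β<α }) _ inner∈β inner∈) inner∈
          outer-ok = source∈ after , λ {β} _ on → outer-off β (on-comp on)

    -- Countable maximal families of components

    Meet : Rel Node ℓ
    Meet N N′ = ∃[ x ] Comp N x × Comp N′ x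

    Big : Pred Vertex ℓ → Set ℓ
    Big D = ∀ w → ∃[ i ] (∀ n → Outside w (vertex (t i) n)) × D (vertex (t i) 0)

    comp-anti : ∀ {N N′} → (∀ {v} → Range (hull N) v → Range (hull N′) v) → Comp N (base N′) → Comp N′ ⊆ Comp N
    comp-anti z⊆z′ base∈ x∈ = base∈ ⊙ walk-map (λ v∉z′ v∈z → v∉z′ (z⊆z′ v∈z)) x∈

    meet-anti : ∀ {N N′} → (∀ {v} → Range (hull N) v → Range (hull N′) v) → Meet N N′ → Comp N′ ⊆ Comp N
    meet-anti {N} {N′} z⊆z′ (x , x∈N , x∈N′) = comp-anti {N} {N′} z⊆z′ (x∈N ⊙ walk-map (λ v∉z′ v∈z → v∉z′ (z⊆z′ v∈z)) (walk-sym x∈N′))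

    everything-big : Big (λ _ → Lift ℓ ⊤)
    everything-big w
      with i , misses ← avoiding (λ i → OnRay (t i)) t-disjoint w
      = i , (λ { n (m , p) → misses m (n , sym p) }) , lift tt

    module FewComponents (few : ¬ (Σ[ f ∈ (κ → Node) ] Disjoint (Comp ∘ f))) where

      Maximal : Pred Node ℓ → Set ℓ
      Maximal P = Σ[ g ∈ (ℕ → Node) ] (∀ n → P (g n)) × (∀ N → P N → ∃[ n ] Meet (g n) N)

      opaque
        -- Otherwise each sequence in `P` would leave room for a node disjoint from all its members,
        -- and `greedy` would build the family that `few` excludes.
        maximal : (P : Pred Node ℓ) → ∃[ N ] P N → Maximal P
        maximal P N₀ = dne λ none →
          let f , f-disjoint = greedy {A = ∃[ N ] P N} (λ N N′ → ¬ Meet (proj₁ N) (proj₁ N′)) N₀ λ g →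
                dne λ stuck → none (proj₁ ∘ g , proj₂ ∘ g , λ N PN →
                  dne λ ¬meet → stuck ((N , PN) , λ n meet → ¬meet (n , meet)))
          in few (proj₁ ∘ f , ≢⇒related {P = λ α β → ∀ x → Comp (proj₁ (f α)) x → ¬ Comp (proj₁ (f β)) x}
                (λ β<α x x∈β x∈α → f-disjoint β<α (x , x∈β , x∈α)) (λ d x x∈ x∈′ → d x x∈′ x∈))

        -- Smallness passes to countable unions: if all members of a maximal family were small,
        -- witnessed by `w n`, a ray of `t` starting in `D` and avoiding `z` and every `w n` would
        -- still start in one of them.
        big-comp : ∀ {D} → Big D → ∀ z → Closed z → ∃[ N ] hull N ≡ z × D (base N) × Big (Comp N)
        big-comp {D} D-big z z-closed = dne λ none →
          let i₀ , i₀-avoids , i₀∈D = D-big z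
              P N = hull N ≡ z × D (base N)
              g , Pg , g-meets = maximal P (record { hull = z ; closed = z-closed ; index = i₀ ; avoids = i₀-avoids } , refl , i₀∈D)
              small : ∀ n → ∃[ w ] ¬ (∃[ i ] (∀ m → Outside w (vertex (t i) m)) × Comp (g n) (vertex (t i) 0))
              small n = ¬∀⇒∃¬ λ big → none (g n , proj₁ (Pg n) , proj₂ (Pg n) , big)
              w n = proj₁ (small n)
              i , i-avoids , i∈D = D-big (z ∪ₛ ⋃ w)
              N = record { hull = z ; closed = z-closed ; index = i ; avoids = λ m v∈z → i-avoids m (∈∪ˡ z (⋃ w) v∈z) }
              n , meet = g-meets N (refl , i∈D)
          in proj₂ (small n) (i , (λ m v∈w → i-avoids m (∈∪ʳ z (⋃ w) (∈⋃ w n v∈w))) ,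
               meet-anti {g n} {N} (λ {v} → subst (λ z′ → Range z′ v) (proj₁ (Pg n))) meet (base∈Comp N))

      Cut : Vertex → Pred Node ℓ
      Cut u N = Big (Comp N) × ¬ Comp N u × (∀ a → Comp N a → ¬ Adj a u)

      cut-family : ∀ {u} → Dec (∃[ N ] Cut u N) → ℕ → Vertex
      cut-family {u} (yes N) = ⋃ (hull ∘ proj₁ (maximal (Cut u) N))
      cut-family     (no _)  = vertex r₀

      cut-family-meets : ∀ {u N} (d : Dec (∃[ N ] Cut u N)) → Cut u N →
                         ∃[ N′ ] Cut u N′ × Meet N′ N × (∀ {v} → Range (hull N′) v → Range (cut-family d) v)
      cut-family-meets {u} {N} (yes N₀) cut
        with g , Pg , g-meets ← maximal (Cut u) N₀
        with n , meet ← g-meets N cut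
        = g n , Pg n , meet , ∈⋃ (hull ∘ g) n
      cut-family-meets {N = N} (no none) cut = ⊥-elim (none (N , cut))

      record Core : Set ℓ where
        field
          Z        : ℕ → Vertex
          Z-closed : Closed Z
          C        : Node
          hull-C   : hull C ≡ Z
          C-big    : Big (Comp C)

        Neighbour : Pred Vertex ℓ
        Neighbour u = Range Z u × ∃[ a ] Comp C a × Adj a u

        Below : Pred Node ℓ
        Below N = (∀ {v} → Range Z v → Range (hull N) v) × Comp C (base N) × Big (Comp N)

        field
          persistent : ∀ {u} → Neighbour u → ∀ {N} → Below N → ∃[ a ] Comp N a × Adj a u

      opaque
        core : Core
        core = record { Z = Z ; Z-closed = Z-closed ; C = C ; hull-C = hull-C ; C-big = proj₂ (proj₂ (proj₂ found)) ; persistent = persistent }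
          where
          centre : ClosedHull (λ u → cut-family {u} em) (vertex r₀)
          centre = closedHull (λ u → cut-family {u} em) (vertex r₀)
          Z : ℕ → Vertex
          Z = ClosedHull.hull centre
          Z-closed : Closed Z
          Z-closed = ClosedHull.closed centre
          found : ∃[ N ] hull N ≡ Z × Lift ℓ ⊤ × Big (Comp N)
          found = big-comp everything-big Z Z-closed
          C : Node
          C = proj₁ found
          hull-C : hull C ≡ Z
          hull-C = proj₁ (proj₂ found)
          persistent : ∀ {u} → Range Z u × (∃[ a ] Comp C a × Adj a u) →
                       ∀ {N} → (∀ {v} → Range Z v → Range (hull N) v) × Comp C (base N) × Big (Comp N) →
                       ∃[ a ] Comp N a × Adj a u
          -- If `u` had no neighbour in the component of `N`, this component would meet that of some
          -- `N′` in the maximal cut family of `u`. The hull of `N′` lies in `Z`, so the component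
          -- of `N′` contains that of `C`, including `a`, although `N′` is cut off from `u`.
          persistent {u} (u∈Z , a , a∈C , a~u) {N} (Z⊆ , N∈C , N-big) = dne λ none →
            let N′ , (_ , _ , N′-cut) , (x , x∈N′ , x∈N) , N′⊆ = cut-family-meets {u} {N} em
                  (N-big , (λ u∈N → target∈ u∈N (Z⊆ u∈Z)) , λ a a∈N a~u → none (a , a∈N , a~u))
                x∈C = comp-anti {C} {N} (λ {v} v∈C → Z⊆ (subst (λ z → Range z v) hull-C v∈C)) N∈C x∈N
                a∈N′ = meet-anti {N′} {C} (λ {v} v∈N′ → subst (λ z → Range z v) (sym hull-C) (ClosedHull.extra⊆ centre u∈Z (N′⊆ v∈N′)))
                         (x , x∈N′ , x∈C) a∈C
            in N′-cut a a∈N′ a~u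

      -- Combs attached to the core

      module CoreCombs (core : Core) where
        open Core core

        opaque
          -- A ray of the end inside `C` reaches `r₀` outside `F`, and since `r₀` lies in the hull,
          -- the walk must leave the component through a vertex of `Z`.
          neighbours-infinite : ∀ F → ∃[ u ] u ∉ˡ F × Neighbour u
          neighbours-infinite F with k , n , p ← end-reach (t∈ε (index C)) F =
            Exit.outer leaving , source∈ (Exit.after leaving) ,
            subst (λ z → Range z (Exit.outer leaving)) hull-C (boundary C inner∈ (Exit.crossing leaving) (Exit.outside leaving)) ,
            Exit.inner leaving , inner∈ , Exit.crossing leaving
            where
            leaving : Exit (Avoids F) (Comp C) (vertex (t (index C)) k) (vertex r₀ n)
            leaving = exit (decide (Comp C)) p (ray⊆Comp C k) (λ r∈C → target∈ r∈C (r₀⊆ C n))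
            inner∈ : Comp C (Exit.inner leaving)
            inner∈ = proj₂ (target∈ (Exit.before leaving))

        record Teeth : Set ℓ where
          field
            u           : ℕ → Vertex
            u-neighbour : ∀ n → Neighbour (u n)
            u-fresh     : ∀ {m n} → m <ℕ n → u m ≢ u n

        opaque
          teeth : Teeth
          teeth = record
            { u           = term
            ; u-neighbour = λ n → proj₂ (term-spec n)
            ; u-fresh     = λ {m} {n} m<n eq → proj₁ (term-spec n) (subst (_∈ˡ history n) eq (earlier m<n))
            }
            where open History {P = λ _ F u → u ∉ˡ F × Neighbour u} (λ _ → neighbours-infinite)

        -- `W` is the countable set that the new comb has to avoid.
        module Tower (teeth : Teeth) (W : ℕ → Vertex) where
          open Teeth teeth

          record State : Set ℓ where
            field
              node  : Node
              below : Below node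
              W⊆    : ∀ {v} → Range W v → Range (hull node) v
              tip   : Vertex
              tip∈  : Comp node tip

          open State

          -- A finite connected block joins the tip to a neighbour of `u`, to the base of a ray of
          -- `t`, and to a neighbour of the next tip; the next component avoids the block.
          -- `base-used` will make the rays of `t` at different levels distinct.
          record Link (u : Vertex) (σ σ′ : State) : Set ℓ where
            field
              block     : List Vertex
              block⊆    : ∀ {v} → v ∈ˡ block → Comp (node σ) v
              block∉    : ∀ {v} → v ∈ˡ block → ¬ Comp (node σ′) v
              hull⊆     : ∀ {v} → Range (hull (node σ)) v → Range (hull (node σ′)) v
              shrinks   : Comp (node σ′) ⊆ Comp (node σ)
              connected : ∀ {v} → v ∈ˡ block → Walk (_∈ˡ block) (tip σ) v
              tip∈block : tip σ ∈ˡ block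
              tooth     : ∃[ a ] a ∈ˡ block × Adj a u
              base∈     : base (node σ) ∈ˡ block
              base-used : Range (hull (node σ′)) (base (node σ))
              exits     : ∃[ d ] d ∈ˡ block × Adj d (tip σ′)

          Refines : Node → List Vertex → Node → Set ℓ
          Refines N l N′ = (∀ {v} → Range (hull N) v → Range (hull N′) v) × (∀ {v} → v ∈ˡ l → Range (hull N′) v) ×
                           Comp N (base N′) × Big (Comp N′)

          opaque
            refine-node : ∀ N → Big (Comp N) → ∀ l → ∃[ N′ ] Refines N l N′
            refine-node N N-big l
              with z ← hull-of (l ◂ hull N)
              with N′ , refl , N′∈N , N′-big ← big-comp {Comp N} N-big (ClosedHull.hull z) (ClosedHull.closed z)
              = N′ , (λ v∈ → ClosedHull.base⊆ z (∈◂ʳ l (hull N) v∈)) , (λ v∈ → ClosedHull.base⊆ z (∈◂ˡ (hull N) v∈)) , N′∈N , N′-big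

          module Step {u} (σ : State) {a} (a~u : Adj a u)
                      (p : Walk (Comp (node σ)) (tip σ) a) (q : Walk (Comp (node σ)) (tip σ) (base (node σ)))
                      (N′ : Node) (refines : Refines (node σ) (verts p ++ verts q) N′)
                      (entry : Exit (Comp (node σ)) (λ v → ¬ Comp N′ v) (tip σ) (base N′)) where
            open Exit entry

            N : Node
            N = node σ

            grow : ∀ {v} → Range (hull N) v → Range (hull N′) v
            grow = proj₁ refines

            used⊆ : ∀ {v} → v ∈ˡ verts p ++ verts q → Range (hull N′) v
            used⊆ = proj₁ (proj₂ refines)

            N′∈N : Comp N (base N′)
            N′∈N = proj₁ (proj₂ (proj₂ refines))

            Z⊆N : ∀ {v} → Range Z v → Range (hull N) v
            Z⊆N = proj₁ (below σ)

            N′∈C : Comp C (base N′)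
            N′∈C = comp-anti {C} {N} (λ {v} v∈ → Z⊆N (subst (λ z → Range z v) hull-C v∈)) (proj₁ (proj₂ (below σ))) N′∈N

            σ′ : State
            σ′ = record
              { node = N′ ; below = (λ v∈ → grow (Z⊆N v∈)) , N′∈C , proj₂ (proj₂ (proj₂ refines))
              ; W⊆ = λ v∈ → grow (W⊆ σ v∈) ; tip = outer ; tip∈ = dne outside }

            H : List Vertex
            H = (verts p ++ verts q) ++ verts before

            H⊆ : ∀ {v} → v ∈ˡ H → Comp N v
            H⊆ v∈ with ∈-++⁻ (verts p ++ verts q) v∈
            ... | inj₂ v∈₃ = proj₁ (verts⊆ before v∈₃)
            ... | inj₁ v∈u with ∈-++⁻ (verts p) v∈u
            ...   | inj₁ v∈₁ = verts⊆ p v∈₁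
            ...   | inj₂ v∈₂ = verts⊆ q v∈₂

            H∉ : ∀ {v} → v ∈ˡ H → ¬ Comp N′ v
            H∉ v∈ v∈N′ with ∈-++⁻ (verts p ++ verts q) v∈
            ... | inj₁ v∈u = target∈ v∈N′ (used⊆ v∈u)
            ... | inj₂ v∈₃ = proj₂ (verts⊆ before v∈₃) v∈N′

            link : Link u σ σ′
            link = record
              { block     = H
              ; block⊆    = H⊆
              ; block∉    = H∉
              ; hull⊆     = grow
              ; shrinks   = comp-anti {N} {N′} grow N′∈N
              ; connected = connects-++ (verts p ++ verts q) (connects-++ (verts p) (within-verts p) (within-verts q)) (within-verts before)
              ; tip∈block = ∈-++⁺ˡ (∈-++⁺ˡ (source∈verts p))
              ; tooth     = a , ∈-++⁺ˡ (∈-++⁺ˡ (target∈verts p)) , a~u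
              ; base∈     = ∈-++⁺ˡ (∈-++⁺ʳ (verts p) (target∈verts q))
              ; base-used = used⊆ (∈-++⁺ʳ (verts p) (target∈verts q))
              ; exits     = inner , ∈-++⁺ʳ (verts p ++ verts q) (target∈verts before) , crossing
              }

          opaque
            advance : ∀ {u} → Neighbour u → ∀ σ → ∃[ σ′ ] Link u σ σ′
            advance {u} u-nbr σ
              with a , a∈ , a~u ← persistent u-nbr {node σ} (below σ)
              = go (to a∈) (to (base∈Comp (node σ)))
              where
              to : ∀ {v} → Comp (node σ) v → Walk (Comp (node σ)) (tip σ) v
              to v∈ = comp-inside (node σ) (tip∈ σ) (walk-sym (tip∈ σ) ⊙ v∈)
              go : (p : Walk (Comp (node σ)) (tip σ) a) (q : Walk (Comp (node σ)) (tip σ) (base (node σ))) → ∃[ σ′ ] Link u σ σ′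
              go p q with N′ , refines@(_ , used⊆ , N′∈N , _) ← refine-node (node σ) (proj₂ (proj₂ (below σ))) (verts p ++ verts q) =
                Step.σ′ σ a~u p q N′ refines entry , Step.link σ a~u p q N′ refines entry
                where
                -- The first entry into the component of `N′`, expressed as an exit from its
                -- complement. The tip starts in the complement because the new hull contains it.
                entry : Exit (Comp (node σ)) (λ v → ¬ Comp N′ v) (tip σ) (base N′)
                entry = exit (decide (λ v → ¬ Comp N′ v)) (to N′∈N)
                  (λ tip∈N′ → target∈ tip∈N′ (used⊆ (∈-++⁺ˡ (source∈verts p)))) (λ base∉ → base∉ (base∈Comp N′))

            initial : State
            initial
              with z ← hull-of (Z ∪ₛ W)
              with N , refl , N∈C , N-big ← big-comp {Comp C} C-big (ClosedHull.hull z) (ClosedHull.closed z)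
              = record
              { node = N
              ; below = (λ v∈ → ClosedHull.base⊆ z (∈∪ˡ Z W v∈)) , N∈C , N-big
              ; W⊆ = λ v∈ → ClosedHull.base⊆ z (∈∪ʳ Z W v∈) ; tip = base N ; tip∈ = base∈Comp N }

          record Ladder : Set ℓ where
            field
              σ    : ℕ → State
              link : ∀ n → Link (u n) (σ n) (σ (suc n))

          opaque
            ladder : Ladder
            ladder = record { σ = σ ; link = λ n → proj₂ (advance (u-neighbour n) (σ n)) }
              where
              σ : ℕ → State
              σ zero    = initial
              σ (suc n) = proj₁ (advance (u-neighbour n) (σ n))

          -- A ray inside the union of the blocks

          module FromLadder (ladder : Ladder) where
            open Ladder ladder

            module L n = Link (link n)

            H : ℕ → List Vertex
            H = L.block

            c : ℕ → Vertex
            c n = tip (σ n)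

            hull-mono : ∀ {m n} → m ≤ n → ∀ {v} → Range (hull (node (σ m))) v → Range (hull (node (σ n))) v
            hull-mono m≤n v∈ with m≤n⇒m<n∨m≡n m≤n
            ... | inj₂ refl = v∈
            hull-mono {n = suc n} _ v∈ | inj₁ (s≤s m≤n) = L.hull⊆ n (hull-mono m≤n v∈)

            comp-mono : ∀ {m n} → m ≤ n → ∀ {v} → Comp (node (σ n)) v → Comp (node (σ m)) v
            comp-mono m≤n v∈ with m≤n⇒m<n∨m≡n m≤n
            ... | inj₂ refl = v∈
            comp-mono {n = suc n} _ v∈ | inj₁ (s≤s m≤n) = comp-mono m≤n (L.shrinks n v∈)

            H-disjoint : ∀ {m n} → m <ℕ n → ∀ {v} → v ∈ˡ H m → v ∉ˡ H n
            H-disjoint {m} {n} m<n v∈m v∈n = L.block∉ m v∈m (comp-mono m<n (L.block⊆ n v∈n))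

            t-at : ℕ → Ray G
            t-at n = t (index (node (σ n)))

            -- The later hull contains the base of the earlier ray and is avoided by the later ray,
            -- so the two indices differ.
            t-at-disjoint : ∀ {m n} → m <ℕ n → ∀ {v} → OnRay (t-at m) v → ¬ OnRay (t-at n) v
            t-at-disjoint {m} {n} m<n {v} = t-disjoint
              (λ i≡j → avoids (node (σ n)) 0 (subst (λ i → Range (hull (node (σ n))) (vertex (t i) 0)) i≡j (hull-mono m<n (L.base-used m)))) v

            K : ℕ → Vertex
            K = ⋃ λ n → H n ◂ λ _ → c n

            H⊆K : ∀ n {v} → v ∈ˡ H n → Range K v
            H⊆K n v∈ = ∈⋃ (λ n → H n ◂ λ _ → c n) n (∈◂ˡ (λ _ → c n) v∈)

            K⊆H : ∀ {v} → Range K v → ∃[ n ] v ∈ˡ H n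
            K⊆H (k , p) with ∈◂⁻ (H _) (λ _ → c _) (proj₂ (unpair k) , p)
            ... | inj₁ v∈         = proj₁ (unpair k) , v∈
            ... | inj₂ (_ , refl) = proj₁ (unpair k) , L.tip∈block (proj₁ (unpair k))

            K-off-Z : ∀ {v} → Range K v → ¬ Range Z v
            K-off-Z v∈K v∈Z with n , v∈H ← K⊆H v∈K = target∈ (L.block⊆ n v∈H) (proj₁ (below (σ n)) v∈Z)

            K-off-W : ∀ {v} → Range K v → ¬ Range W v
            K-off-W v∈K v∈W with n , v∈H ← K⊆H v∈K = target∈ (L.block⊆ n v∈H) (W⊆ (σ n) v∈W)

            chain : ∀ {A : Pred Vertex ℓ} {N} → (∀ {n} → N ≤ n → ∀ {v} → v ∈ˡ H n → A v) → ∀ {n} → N ≤ n → Walk A (c N) (c n)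
            chain {A} {N} H⊆A {n} N≤n with m≤n⇒m<n∨m≡n N≤n
            ... | inj₂ refl = stop (H⊆A ≤-refl (L.tip∈block N))
            chain {A} {N} H⊆A {suc n} N≤1+n | inj₁ (s≤s N≤n)
              with d , d∈ , adj ← L.exits n
              = chain H⊆A N≤n ⊙ walk-map (H⊆A N≤n) (L.connected n d∈) ⊙ edge (H⊆A N≤n d∈) adj (H⊆A N≤1+n (L.tip∈block (suc n)))

            -- A self-avoiding walk in `K` that is not trapped: from `head` all late tips remain
            -- reachable without touching `visited`.
            record Alive : Set ℓ where
              field
                visited : List Vertex
                head    : Vertex
                N       : ℕ
                reach   : ∀ {n} → N ≤ n → Walk (λ v → Range K v × v ∉ˡ visited) head (c n)

            open Alive

            opaque
              -- Late blocks miss the finitely many vertices used so far. A walk to one late tip is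
              -- followed from its last visit to `head`, and the chain of later blocks extends it to
              -- all later tips.
              move : ∀ (A : Alive) → Σ[ A′ ∈ Alive ] Adj (head A) (head A′) × visited A′ ≡ head A ∷ visited A
              move A
                with M , misses ← eventually-misses (λ n → _∈ˡ H n) H-disjoint (head A ∷ visited A)
                with y , adj , q ← leave-source (λ _ _ → em) (reach A (m≤m+n (N A) M))
                                     (λ c≡head → misses (m≤n+m M (N A)) (here c≡head) (L.tip∈block (N A + M)))
                = record
                  { visited = head A ∷ visited A
                  ; head    = y
                  ; N       = N A + M
                  ; reach   = λ {n} N≤n →
                      walk-map (λ ((v∈K , v∉) , v≢) → v∈K , λ { (here v≡) → v≢ v≡ ; (there v∈) → v∉ v∈ }) q ⊙
                      chain (λ {n} N≤n v∈ → H⊆K n v∈ , λ v∈′ → misses (≤-trans (m≤n+m M (N A)) N≤n) v∈′ v∈) N≤n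
                  } , adj , refl

            alive : ℕ → Alive
            alive zero    = record { visited = [] ; head = c 0 ; N = 0 ; reach = chain λ {n} _ v∈ → H⊆K n v∈ , λ () }
            alive (suc n) = proj₁ (move (alive n))

            s-vertex : ℕ → Vertex
            s-vertex n = head (alive n)

            s-valid : ∀ n → Range K (s-vertex n) × s-vertex n ∉ˡ visited (alive n)
            s-valid n = source∈ (reach (alive n) ≤-refl)

            visited-earlier : ∀ {m n} → m <ℕ n → s-vertex m ∈ˡ visited (alive n)
            visited-earlier {m} {suc n} (s≤s m≤n) =
              subst (s-vertex m ∈ˡ_) (sym (proj₂ (proj₂ (move (alive n))))) (step-back (m≤n⇒m<n∨m≡n m≤n))
              where
              step-back : m <ℕ n ⊎ m ≡ n → s-vertex m ∈ˡ s-vertex n ∷ visited (alive n)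
              step-back (inj₁ m<n)  = there (visited-earlier m<n)
              step-back (inj₂ refl) = here refl

            s-fresh : ∀ {m n} → m <ℕ n → s-vertex m ≢ s-vertex n
            s-fresh {n = n} m<n eq = proj₂ (s-valid n) (subst (_∈ˡ visited (alive n)) eq (visited-earlier m<n))

            opaque
              ray-in-K : Σ[ s ∈ Ray G ] ∀ n → Range K (vertex s n)
              ray-in-K = record
                { vertex    = s-vertex
                ; injective = s-injective
                ; adjacent  = λ n → proj₁ (proj₂ (move (alive n)))
                } , proj₁ ∘ s-valid
                where
                s-injective : ∀ {m n} → s-vertex m ≡ s-vertex n → m ≡ n
                s-injective {m} {n} eq with <-cmp m n
                ... | tri< m<n _ _ = ⊥-elim (s-fresh m<n eq)
                ... | tri≈ _ m≡n _ = m≡n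
                ... | tri> _ _ n<m = ⊥-elim (s-fresh n<m (sym eq))

            module FromRay (s : Ray G) (s⊆K : ∀ n → Range K (vertex s n)) where

              blocks-below : ℕ → List Vertex
              blocks-below zero    = []
              blocks-below (suc n) = H n ++ blocks-below n

              ∈blocks-below : ∀ {m n v} → m <ℕ n → v ∈ˡ H m → v ∈ˡ blocks-below n
              ∈blocks-below {m} {suc n} (s≤s m≤n) v∈ with m≤n⇒m<n∨m≡n m≤n
              ... | inj₁ m<n  = ∈-++⁺ʳ (H n) (∈blocks-below m<n v∈)
              ... | inj₂ refl = ∈-++⁺ˡ v∈

              -- The ray is injective and the blocks below `N` are finite, so some vertex of the ray
              -- lies in none of them.
              s-meets : ∀ N → ∃[ k ] ∃[ n ] N ≤ n × vertex s k ∈ˡ H n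
              s-meets N
                with k , misses ← eventually-misses (λ k v → v ≡ vertex s k) (λ { m<n refl eq → <⇒≢ m<n (Ray.injective s eq) }) (blocks-below N)
                with n , v∈ ← K⊆H (s⊆K k)
                = k , n , dne (λ N≰n → misses ≤-refl (∈blocks-below (≰⇒> N≰n) v∈) refl) , v∈

              base-reach : ∀ n F → (∀ {v} → v ∈ˡ F → ¬ OnRay (t-at n) v) → Reach (Avoids F) (base (node (σ n)))
              base-reach n F misses
                with k , r ← end-reach (t∈ε (index (node (σ n)))) F
                = ray-walk (t-at n) (λ i v∈F → misses v∈F (i , refl)) 0 k ⊙ʳ r

              block-walk : ∀ n F → (∀ {v} → v ∈ˡ F → v ∉ˡ H n) → ∀ {x y} → x ∈ˡ H n → y ∈ˡ H n → Walk (λ v → v ∈ˡ H n × v ∉ˡ F) x y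
              block-walk n F misses x∈ y∈ =
                walk-map (λ v∈ → v∈ , λ v∈F → misses v∈F v∈) (walk-sym (L.connected n x∈) ⊙ L.connected n y∈)

              -- A late block and the ray of `t` based in it both miss `F`; they lead from `s` to a
              -- point from which `r₀` is reachable.
              s∈ε : s ∈ End.rays ε
              s∈ε = reach-end λ F →
                let M₁ , misses₁ = eventually-misses (λ n → _∈ˡ H n) H-disjoint F
                    M₂ , misses₂ = eventually-misses (λ n → OnRay (t-at n)) t-at-disjoint F
                    k , n , N≤n , s∈ = s-meets (M₁ + M₂)
                in k , walk-map proj₂ (block-walk n F (misses₁ (≤-trans (m≤m+n M₁ M₂) N≤n)) s∈ (L.base∈ n)) ⊙ʳ
                       base-reach n F (misses₂ (≤-trans (m≤n+m M₂ M₁) N≤n))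

              attach : ∀ F → ∃[ k ] Reach (λ v → (Range K v ⊎ Range Z v) × v ∉ˡ F) (vertex s k)
              attach F =
                let M₁ , misses₁ = eventually-misses (λ n → _∈ˡ H n) H-disjoint F
                    M₂ , misses₂ = eventually-misses (λ n → OnRay (t-at n)) t-at-disjoint F
                    M₃ , misses₃ = eventually-misses (λ n v → v ≡ u n) (λ { m<n refl eq → u-fresh m<n eq }) F
                    k , n , N≤n , s∈ = s-meets (M₁ + M₂ + M₃)
                    M₁₂≤n = ≤-trans (m≤m+n (M₁ + M₂) M₃) N≤n
                    H∩F = misses₁ (≤-trans (m≤m+n M₁ M₂) M₁₂≤n)
                    a , a∈ , a~u = L.tooth n
                    u∉F = λ u∈F → misses₃ (≤-trans (m≤n+m M₃ (M₁ + M₂)) N≤n) u∈F refl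
                    u∈Z = proj₁ (u-neighbour n)
                    -- This walk only certifies that `u n` reaches `r₀` outside `F`; closedness of
                    -- `Z` then replaces it by a walk inside `Z`.
                    from-u = edge u∉F (adj-sym a~u) (λ a∈F → H∩F a∈F a∈) ⊙ʳ
                             walk-map proj₂ (block-walk n F H∩F a∈ (L.base∈ n)) ⊙ʳ
                             base-reach n F (misses₂ (≤-trans (m≤n+m M₂ M₁) M₁₂≤n))
                in k , walk-map (λ (v∈H , v∉F) → inj₁ (H⊆K n v∈H) , v∉F) (block-walk n F H∩F s∈ a∈) ⊙ʳ
                       edge (inj₁ (H⊆K n a∈) , λ a∈F → H∩F a∈F a∈) a~u (inj₂ u∈Z , u∉F) ⊙ʳ
                       reach-map (λ (v∈Z , v∉F) → inj₂ v∈Z , v∉F) (Closed.reroute Z-closed F u∈Z from-u)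

        record Comb : Set ℓ where
          field
            ray    : Ray G
            K      : ℕ → Vertex
            ray∈ε  : ray ∈ End.rays ε
            ray⊆K  : ∀ n → Range K (vertex ray n)
            off-Z  : ∀ {v} → Range K v → ¬ Range Z v
            attach : ∀ F → ∃[ k ] Reach (λ v → (Range K v ⊎ Range Z v) × v ∉ˡ F) (vertex ray k)

        opaque
          comb : ∀ W → Σ[ T ∈ Comb ] ∀ {v} → Range (Comb.K T) v → ¬ Range W v
          comb W = record
            { ray = s ; K = K ; ray∈ε = s∈ε ; ray⊆K = s⊆K ; off-Z = K-off-Z ; attach = attach } , K-off-W
            where
            open Tower teeth W
            open FromLadder ladder
            s : Ray G
            s = proj₁ ray-in-K
            s⊆K : ∀ n → Range K (vertex s n)
            s⊆K = proj₂ ray-in-K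
            open FromRay s s⊆K

        starFamily : StarFamily
        starFamily = record
          { ray      = ray ∘ f
          ; ray∈ε    = ray∈ε ∘ f
          ; disjoint = λ {α} {β} α≢β m n eq →
              K-disjoint α≢β _ (ray⊆K (f α) m) (subst (Range (K (f β))) (sym eq) (ray⊆K (f β) n))
          ; off-r₀   = λ α m n eq → off-Z (f α) (ray⊆K (f α) m) (subst (Range Z) (sym eq) (Closed.r₀⊆ Z-closed n))
          ; reach    = λ α F → let k , r = attach (f α) F in k , reach-map
              (λ { (inj₁ v∈K , v∉F) → v∉F , λ { {β} β≢α (m , refl) → K-disjoint β≢α _ (ray⊆K (f β) m) v∈K }
                 ; (inj₂ v∈Z , v∉F) → v∉F , λ { {β} β≢α (m , refl) → off-Z (f β) (ray⊆K (f β) m) v∈Z } }) r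
          }
          where
          open Comb
          -- Each new comb avoids the sets `K` of its predecessors, and no `K` meets `Z`, so the
          -- routes through `K` and `Z` miss all other rays.
          combs = greedy {A = Comb} (λ T T′ → ∀ v → Range (K T) v → ¬ Range (K T′) v) (proj₁ (comb (vertex r₀))) λ g →
            let T , T-off = comb (⋃ (K ∘ g)) in T , λ n v v∈ v∈T → T-off v∈T (∈⋃ (K ∘ g) n v∈)
          f = proj₁ combs
          K-disjoint : Disjoint (Range ∘ K ∘ f)
          K-disjoint = ≢⇒related {P = λ α β → ∀ v → Range (K (f α)) v → ¬ Range (K (f β)) v} (proj₂ combs) (λ d v p q → d v q p)

    -- From the star to HC*

    ≈-sym : ∀ (p q : Path G) → p ≈ q → q ≈ p
    ≈-sym _ _ (vs , es) = (λ v → ⇔-sym (vs v)) , λ v w → ⇔-sym (es v w)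

    ≈-trans : ∀ (p q r : Path G) → p ≈ q → q ≈ r → p ≈ r
    ≈-trans _ _ _ (vs , es) (vs′ , es′) = (λ v → vs′ v ⇔-∘ vs v) , λ v w → es′ v w ⇔-∘ es v w

    endpoint-on : (p : Path G) → ∀ {v} → EndpointOf p v → OnPath p v
    endpoint-on p (inj₁ eq) = zero , eq
    endpoint-on p (inj₂ eq) = fromℕ (Path.length p) , eq

    -- One path from each class of `R`-paths

    module CanonicalPaths (R : κ → Ray G) where

      RPath : Path G → Set ℓ
      RPath p = (∀ v → EndpointOf p v → ∃[ i ] OnRay (R i) v)
              × (∀ i v → OnPath p v → OnRay (R i) v → EndpointOf p v)

      -- `≈` does not mention endpoints, but those of `p` lie on rays of `R`, which `q` meets only
      -- in its own endpoints.
      endpoint-≈ : ∀ (p q : Path G) → RPath p → RPath q → p ≈ q → ∀ {v} → EndpointOf p v → EndpointOf q v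
      endpoint-≈ p q p-R q-R (vs , _) {v} end
        with i , on ← proj₁ p-R v end
        = proj₂ q-R i v (Equivalence.to (vs v) (endpoint-on p end)) on

      -- Without quotients or propositional extensionality, an equivalence
      -- class is represented by its characteristic function, from which
      -- excluded middle then picks an element.
      Class : Path G → Path G → Set ℓ
      Class p q = RPath q × q ≈ p

      does-sound : ∀ {P : Set ℓ} (d : Dec P) → does d ≡ true → P
      does-sound (yes p) _ = p

      opaque
        class : Path G → Path G → Bool
        class p q = does (em {P = Class p q})

        class-cong : ∀ (p p′ : Path G) → p ≈ p′ → class p ≡ class p′
        class-cong p p′ p≈p′ = ext λ q → does-⇔
          (mk⇔ (λ (q-R , q≈p) → q-R , ≈-trans q p p′ q≈p p≈p′) (λ (q-R , q≈p′) → q-R , ≈-trans q p′ p q≈p′ (≈-sym p p′ p≈p′)))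
          (em {P = Class p q}) (em {P = Class p′ q})

        class-sound : ∀ p q → class p q ≡ true → Class p q
        class-sound p q = does-sound (em {P = Class p q})

        class-refl : ∀ p → RPath p → class p p ≡ true
        class-refl p p-R = dec-true (em {P = Class p p}) (p-R , (λ _ → ⇔-id _) , λ _ _ → ⇔-id _)

      Pick : (Path G → Bool) → Set ℓ
      Pick χ = ∃[ q ] χ q ≡ true

      pick : ∀ χ → Dec (Pick χ) → Maybe (Path G)
      pick χ (yes (q , _)) = just q
      pick χ (no _)        = nothing

      pick-class : ∀ p → RPath p → (d : Dec (Pick (class p))) → ∃[ q ] Class p q × pick (class p) d ≡ just q
      pick-class p p-R (yes (q , eq)) = q , class-sound p q eq , refl
      pick-class p p-R (no none)      = ⊥-elim (none (p , class-refl p p-R))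

      pick-any : (Path G → Bool) → Maybe (Path G)
      pick-any χ = pick χ (em {P = Pick χ})

      opaque
        canonical : Path G → Maybe (Path G)
        canonical p = pick-any (class p)

        canonical-cong : ∀ (p p′ : Path G) → p ≈ p′ → canonical p ≡ canonical p′
        canonical-cong p p′ p≈p′ = cong pick-any (class-cong p p′ p≈p′)

        canonical-class : ∀ p → RPath p → ∃[ q ] Class p q × canonical p ≡ just q
        canonical-class p p-R = pick-class p p-R (em {P = Pick (class p)})

      IsCanonical : Pred (Path G) ℓ
      IsCanonical p = RPath p × canonical p ≡ just p

      -- The path family is fixed before `R′` is given, so it represents every class of `R`-paths;
      -- the spokes for any `R′` can then be found in it.
      Q : Set ℓ
      Q = [ p ∈ Path G ∣ IsCanonical p ]

      is-canonical : ∀ (x : Q) → IsCanonical (value {P = IsCanonical} x)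
      is-canonical (_ , [ p ]) = recompute′ p

      P : PathFamily G Q
      P = record
        { path     = value
        ; distinct = λ {x} {y} x≈y → value-injective (just-injective
            (trans (sym (proj₂ (is-canonical x))) (trans (canonical-cong (value x) (value y) x≈y) (proj₂ (is-canonical y)))))
        }

      opaque
        representative : ∀ p → RPath p → ∃[ x ] p ≈ PathFamily.path P x
        representative p p-R with q , (q-R , q≈p) , eq ← canonical-class p p-R =
          (q , [ q-R , trans (canonical-cong q p q≈p) eq ]) , ≈-sym q p q≈p

    -- Spokes to the centre `r₀`

    module FromStars (stars : StarFamily) where
      open StarFamily stars

      o o′ : κ
      o  = κ-element
      o′ = proj₁ (another-element o)

      place : ∀ {α} → Dec (α ≡ o) → Ray G
      place         (yes _) = r₀
      place {α = α} (no _)  = ray α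

      -- `r₀` takes the place of the ray at `o`, so the family together with its centre is again
      -- indexed by `κ`.
      R : κ → Ray G
      R α = place {α} em

      on-R : ∀ {α v} → OnRay (R α) v → (α ≡ o × OnRay r₀ v) ⊎ (α ≢ o × OnRay (ray α) v)
      on-R {α} on with em {P = α ≡ o}
      ... | yes α≡o = inj₁ (α≡o , on)
      ... | no α≢o  = inj₂ (α≢o , on)

      on-R-o : ∀ {v} → OnRay r₀ v → OnRay (R o) v
      on-R-o on with em {P = o ≡ o}
      ... | yes _  = on
      ... | no o≢o = ⊥-elim (o≢o refl)

      on-R-ray : ∀ {α v} → α ≢ o → OnRay (ray α) v → OnRay (R α) v
      on-R-ray {α} α≢o on with em {P = α ≡ o}
      ... | yes α≡o = ⊥-elim (α≢o α≡o)
      ... | no _    = on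

      R∈ε : ∀ α → R α ∈ End.rays ε
      R∈ε α with em {P = α ≡ o}
      ... | yes _ = r₀∈ε
      ... | no _  = ray∈ε α

      R-disjoint : PairwiseDisjoint R
      R-disjoint {α} {β} α≢β v on-α on-β with on-R {α} on-α | on-R {β} on-β
      ... | inj₁ (refl , _)     | inj₁ (refl , _)     = α≢β refl
      ... | inj₁ (_ , n , refl) | inj₂ (_ , m , eq)   = off-r₀ β m n eq
      ... | inj₂ (_ , m , eq)   | inj₁ (_ , n , refl) = off-r₀ α m n eq
      ... | inj₂ (_ , m , refl) | inj₂ (_ , n , eq)   = disjoint α≢β m n (sym eq)

      open CanonicalPaths R

      path-verts : Path G → List Vertex
      path-verts p = tabulate (Path.vertex p)

      on⇒∈ : (p : Path G) → ∀ {v} → OnPath p v → v ∈ˡ path-verts p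
      on⇒∈ p (i , refl) = ∈-tabulate⁺ {f = Path.vertex p} i

      all-verts : List (Path G) → List Vertex
      all-verts L = concat (map path-verts L)

      record Spoke (α : κ) (L : List (Path G)) (p : Path G) : Set ℓ where
        field
          isRPath : RPath p
          start∈  : OnRay (R α) (Path.start p)
          end∈    : OnRay (R o) (Path.end p)
          fresh   : ∀ {q} → q ∈ˡ L → ∀ {v} → OnPath q v → ¬ OnPath p v

      opaque
        spoke : ∀ {α} → α ≢ o → ∀ L → ∃[ p ] Spoke α L p
        spoke {α} α≢o L with k , n , w ← reach α (all-verts L) = path , record
          { isRPath = endpoints , internally-disjoint
          ; start∈  = on-R-ray α≢o starts
          ; end∈    = on-R-o ends
          ; fresh   = λ {q} q∈L on-q on-p → proj₁ (inside on-p) (∈-concat⁺′ (on⇒∈ q on-q) (∈-map⁺ path-verts q∈L))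
          }
          where
          open PathIn (shortest (λ P → em {P = P}) {S = OnRay (ray α)} {B = OnRay r₀} w (k , refl) (n , refl))
          endpoints : ∀ v → EndpointOf path v → ∃[ i ] OnRay (R i) v
          endpoints v (inj₁ refl) = α , on-R-ray α≢o starts
          endpoints v (inj₂ refl) = o , on-R-o ends
          internally-disjoint : ∀ i v → OnPath path v → OnRay (R i) v → EndpointOf path v
          internally-disjoint i v on on-i with on-R {i} on-i
          ... | inj₁ (_ , on-r₀) = inj₂ (at-end on on-r₀)
          ... | inj₂ (_ , on-ray) with em {P = i ≡ α}
          ...   | yes refl = inj₁ (at-start on on-ray)
          ...   | no i≢α   = ⊥-elim (proj₂ (inside on) i≢α on-ray)

      -- `q` may run in the opposite direction. Both ends of `p` cannot match the same end of `q`,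
      -- since `R α` and `R o` are disjoint.
      joins-≈ : ∀ (p q : Path G) {α} → α ≢ o → RPath p → RPath q → p ≈ q →
                OnRay (R α) (Path.start p) → OnRay (R o) (Path.end p) → Joins q (R α) (R o)
      joins-≈ p q {α} α≢o p-R q-R p≈q start∈ end∈
        with endpoint-≈ p q p-R q-R p≈q (inj₁ refl) | endpoint-≈ p q p-R q-R p≈q (inj₂ refl)
      ... | inj₁ s | inj₂ e = inj₁ (subst (OnRay (R α)) (sym s) start∈ , subst (OnRay (R o)) (sym e) end∈)
      ... | inj₂ s | inj₁ e = inj₂ (subst (OnRay (R o)) (sym e) end∈ , subst (OnRay (R α)) (sym s) start∈)
      ... | inj₁ s | inj₁ e = ⊥-elim (R-disjoint α≢o _ start∈ (subst (OnRay (R o)) (trans (sym e) s) end∈))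
      ... | inj₂ s | inj₂ e = ⊥-elim (R-disjoint α≢o _ start∈ (subst (OnRay (R o)) (trans (sym e) s) end∈))

      record SpokeSystem (leaf : ℕ → κ) : Set ℓ where
        field
          spokes          : ℕ → Q
          spokes-join     : ∀ n → Joins (value (spokes n)) (R (leaf n)) (R o)
          spokes-disjoint : ∀ {m n v} → OnPath (value (spokes m)) v → OnPath (value (spokes n)) v → m ≡ n

      opaque
        spokeSystem : ∀ leaf → (∀ n → leaf n ≢ o) → SpokeSystem leaf
        spokeSystem leaf leaf≢o = record
          -- Passing to representatives preserves vertex sets, hence disjointness.
          { spokes          = q
          ; spokes-join     = λ n → joins-≈ (p n) (value (q n)) (leaf≢o n) (p.isRPath n) (proj₁ (is-canonical (q n))) (p≈q n) (p.start∈ n) (p.end∈ n)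
          ; spokes-disjoint = λ {m} {n} → q-disjoint {m} {n}
          }
          where
          module Spokes = History {P = λ n → Spoke (leaf n)} (λ n → spoke (leaf≢o n))
          p : ℕ → Path G
          p = Spokes.term
          module p n = Spoke (Spokes.term-spec n)
          q : ℕ → Q
          q n = proj₁ (representative (p n) (p.isRPath n))
          p≈q : ∀ n → p n ≈ value (q n)
          p≈q n = proj₂ (representative (p n) (p.isRPath n))
          on-p : ∀ n {v} → OnPath (value (q n)) v → OnPath (p n) v
          on-p n {v} = Equivalence.from (proj₁ (p≈q n) v)
          q-disjoint : ∀ {m n v} → OnPath (value (q m)) v → OnPath (value (q n)) v → m ≡ n
          q-disjoint {m} {n} on-m on-n with <-cmp m n
          ... | tri< m<n _ _ = ⊥-elim (p.fresh n (Spokes.earlier m<n) (on-p m on-m) (on-p n on-n))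
          ... | tri≈ _ m≡n _ = m≡n
          ... | tri> _ _ n<m = ⊥-elim (p.fresh m (Spokes.earlier n<m) (on-p n on-n) (on-p m on-m))

      module CountablePart (R′ : Pred κ ℓ) (R′-countable : CountableSubset R′) where

        enumeration = subset-enumeration R′ o R′-countable

        e : ℕ → κ
        -- The centre has position 0, and position 1 holds `o′`, the substitute leaf wherever `e`
        -- names the centre.
        e = (o ∷ o′ ∷ []) ◂ proj₁ enumeration

        leaf-of : ∀ {α} → Dec (α ≡ o) → κ
        leaf-of         (yes _) = o′
        leaf-of {α = α} (no _)  = α

        -- Every leaf is named infinitely often.
        leaf : ℕ → κ
        leaf n = leaf-of {e (proj₁ (unpair n))} em

        leaf≢o : ∀ n → leaf n ≢ o
        leaf≢o n with em {P = e (proj₁ (unpair n)) ≡ o}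
        ... | yes _  = proj₂ (another-element o)
        ... | no e≢o = e≢o

        leaf∈ : ∀ n → Range e (leaf n)
        leaf∈ n with em {P = e (proj₁ (unpair n)) ≡ o}
        ... | yes _ = 1 , refl
        ... | no _  = proj₁ (unpair n) , refl

        leaf-onto : ∀ {α} → α ≢ o → Range e α → ∀ k → ∃[ n ] leaf n ≡ α × proj₂ (unpair n) ≡ k
        leaf-onto α≢o (m , refl) k with n , eq ← unpair-surjective m k = n , leaf≡ , cong proj₂ eq
          where
          leaf≡ : leaf n ≡ e m
          leaf≡ with em {P = e (proj₁ (unpair n)) ≡ o}
          ... | yes e≡o = ⊥-elim (α≢o (trans (cong (e ∘ proj₁) (sym eq)) e≡o))
          ... | no _    = cong (e ∘ proj₁) eq

        open SpokeSystem (spokeSystem leaf leaf≢o)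

        R″ : Pred κ ℓ
        R″ = Range e

        P″ : Pred Q ℓ
        P″ = Range spokes

        P″-countable : CountableSubset P″
        P″-countable = Range-countable spokes

        index-of : (x : [ x ∈ Q ∣ P″ x ]) → ∃[ n ] spokes n ≡ value x
        index-of (_ , [ x∈ ]) = recompute′ x∈

        over : IsFamilyOver (R ↾ʳ R″) (P ↾ᵖ P″)
        over x v end = on-endpoint (value (spokes (proj₁ (index-of x)))) (spokes-join (proj₁ (index-of x)))
          (subst (λ q → EndpointOf (value q) v) (sym (proj₂ (index-of x))) end)
          where
          at-leaf : OnRay (R (leaf (proj₁ (index-of x)))) v → ∃[ i ] OnRay ((R ↾ʳ R″) i) v
          at-leaf on = (_ , [ leaf∈ (proj₁ (index-of x)) ]) , on
          at-o : OnRay (R o) v → ∃[ i ] OnRay ((R ↾ʳ R″) i) v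
          at-o on = (o , [ (0 , refl) ]) , on
          on-endpoint : ∀ p → Joins p (R (leaf (proj₁ (index-of x)))) (R o) → EndpointOf p v → ∃[ i ] OnRay ((R ↾ʳ R″) i) v
          on-endpoint _ (inj₁ (s , _)) (inj₁ refl) = at-leaf s
          on-endpoint _ (inj₁ (_ , e)) (inj₂ refl) = at-o e
          on-endpoint _ (inj₂ (s , _)) (inj₁ refl) = at-o s
          on-endpoint _ (inj₂ (_ , e)) (inj₂ refl) = at-leaf e

        independent : Independent (P ↾ᵖ P″)
        independent {x} {y} x≢y v on-x on-y = ⊥-elim (x≢y (value-injective
          (trans (sym (proj₂ (index-of x))) (trans (cong spokes same) (proj₂ (index-of y))))))
          where
          on-spoke : ∀ z → OnPath (value (value z)) v → OnPath (value (spokes (proj₁ (index-of z)))) v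
          on-spoke z = subst (λ q → OnPath (value q) v) (sym (proj₂ (index-of z)))
          same : proj₁ (index-of x) ≡ proj₁ (index-of y)
          same = spokes-disjoint (on-spoke x on-x) (on-spoke y on-y)

        private module Γ = Graph (rayGraph (R ↾ʳ R″) (P ↾ᵖ P″))

        centre : Γ.Vertex
        centre = o , [ (0 , refl) ]

        adjacent-centre : ∀ (x : Γ.Vertex) → value x ≢ o → Γ.Adj x centre
        adjacent-centre (α , [ α∈ ]) α≢o = (λ { refl → α≢o refl }) ,
          mk↣ {to = λ k → spokes (n k) , [ (n k , refl) ]} (λ {j} {k} eq → n-injective (cong value eq)) ,
          λ k → subst (λ β → Joins (value (spokes (n k))) (R β) (R o)) (proj₁ (proj₂ (named k))) (spokes-join (n k))
          where
          named : ∀ k → ∃[ n ] leaf n ≡ α × proj₂ (unpair n) ≡ k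
          named = leaf-onto α≢o (recompute′ α∈)
          n : ℕ → ℕ
          n k = proj₁ (named k)
          n-injective : ∀ {j k} → spokes (n j) ≡ spokes (n k) → j ≡ k
          n-injective {j} {k} eq =
            trans (sym (proj₂ (proj₂ (named j))))
              -- Equal spokes share their start, so disjointness makes `spokes` injective; the
              -- second coordinate of the stage then recovers the counter.
              (trans (cong (proj₂ ∘ unpair) (spokes-disjoint (zero , refl) (zero , cong (Path.start ∘ value) (sym eq))))
                (proj₂ (proj₂ (named k))))

        to-centre : ∀ x → Star Γ.Adj x centre
        to-centre x with em {P = value x ≡ o}
        ... | yes x≡o = subst (Star Γ.Adj x) (value-injective x≡o) Star.ε
        ... | no x≢o  = adjacent-centre x x≢o ◅ Star.ε

        connected : Connected (rayGraph (R ↾ʳ R″) (P ↾ᵖ P″))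
        connected = centre , λ x y → to-centre x Star.◅◅ Star.reverse (λ {x} {y} → Γ.adj-sym {x} {y}) (to-centre y)

      hc* : HC* ε κ
      hc* = R , (R∈ε , R-disjoint) , Q , P ,
        (λ x v → proj₁ (proj₁ (is-canonical x)) v) ,
        (λ x i v → proj₂ (proj₁ (is-canonical x)) i v) ,
        λ R′ R′-countable →
          let open CountablePart R′ R′-countable in
          R″ , (λ {α} α∈R′ → ∈◂ʳ (o ∷ o′ ∷ []) (proj₁ enumeration) (proj₂ enumeration α α∈R′)) ,
          Range-countable e , P″ , P″-countable , over , (λ {x} {y} → independent {x} {y}) , connected

    opaque
      star-family : StarFamily
      star-family with em {P = Σ[ f ∈ (κ → Node) ] Disjoint (Comp ∘ f)}
      ... | yes (f , f-disjoint) = ManyComponents.starFamily f f-disjoint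
      ... | no few               = FewComponents.CoreCombs.starFamily few (FewComponents.core few)

    end-hc* : HC* ε κ
    end-hc* = FromStars.hc* star-family

theorem3 : (∀ {a} → ExcludedMiddle a) →
    (∀ {a b} → Extensionality a b) →
    ∀ {ℓ} (G : Graph ℓ) (ε : End G) (κ : Set ℓ) →
    IsAleph₁ κ →
    HasDegree ε κ →
    HC* ε κ
theorem3 em ext G ε κ (_ , isOmega₁) degree
  with t , t-family ← Omega₁.degree-family em ext isOmega₁ ε degree
  with r₀ , r₀∈ε ← End.nonempty ε
  = end-hc* em ext isOmega₁ ε t t-family r₀ r₀∈ε
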